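{- For every integer $k\ge 3$ the generating function $F_{21\text{ - }3\text{ - }\cdots\text{ - }k;r}(x)$, $0\le r\le k-2$, is a rational function given by $$F_{21\text{ - }3\text{ - }\cdots\text{ - }k;r}(x)=\frac{x^{\frac{r-1}{2}}\,U_{k-1}^{\,r-1}\!\left(\frac1{2\sqrt x}\right)}{U_k^{\,r+1}\!\left(\frac1{2\sqrt x}\right)}\qquad (1\le r\le k-2),$$ $$F_{21\text{ - }3\text{ - }\cdots\text{ - }k;0}(x)=\frac{U_{k-1}\!\left(\frac1{2\sqrt x}\right)}{\sqrt x\,U_k\!\left(\frac1{2\sqrt x}\right)},$$ where $U_j$ is the $j$th Chebyshev polynomial of the second kind.
   Context: Generalized patterns: a generalized pattern is a permutation $\tau=\tau_1\cdots\tau_k$ of $\{1,\dots,k\}$ written with dashes between some of its adjacent letters. An occurrence of $\tau$ in $\pi=\pi_1\cdots\pi_n\in S_n$ is a choice of positions $i_1<\dots<i_k$ such that $(\pi_{i_1},\dots,\pi_{i_k})$ is order-isomorphic to $(\tau_1,\dots,\tau_k)$ and $i_{j+1}=i_j+1$ whenever there is no dash between $\tau_j$ and $\tau_{j+1}$. The pattern $21\text{ - }3\text{ - }\cdots\text{ - }k$ requires only the first two letters to be adjacent in $\pi$. A permutation is $1\text{ - }3\text{ - }2$-avoiding if it has no occurrence of the classical (fully dashed) pattern $1\text{ - }3\text{ - }2$. $f_{\tau;r}(n)$ is the number of $1\text{ - }3\text{ - }2$-avoiding permutations in $S_n$ containing exactly $r$ occurrences of $\tau$ (with $S_0$ consisting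 of the empty permutation), and $F_{\tau;r}(x)=\sum_{n\ge 0} f_{\tau;r}(n)x^n$. Chebyshev polynomials of the second kind: $U_j(\cos\theta)=\sin((j+1)\theta)/\sin\theta$. The exponents on $U$ denote powers. -}

module Defs where

open import Level using (0ℓ)
open import Algebra.Bundles using (CommutativeRing)
open import Algebra.Bundles.Raw using (RawRing)
open import Data.Bool.Base using (Bool; true; false)
import Data.Bool.Properties as Bool
open import Data.Fin.Base as Fin using (Fin; toℕ)
import Data.Fin.Properties as Fin
open import Data.Fin.Permutation
  using (Permutation′; _⟨$⟩ʳ_; id; swap; lift₀)
open import Data.Integer.Base using (+_)
open import Data.List.Base
  using (List; []; _∷_; length; filter; allFin; cartesianProductWith)
open import Data.Nat.Base as ℕ using (ℕ; zero; suc; _∸_)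
import Data.Nat.Properties as ℕ
open import Data.Product.Base using (∃-syntax; _×_; _,_; uncurry)
open import Data.Rational.Base as ℚ using (ℚ; 0ℚ; 1ℚ; ½; _/_)
open import Data.Vec.Base using (Vec; []; _∷_; lookup)
open import Data.Vec.Relation.Unary.AllPairs using (allPairs?)
open import Data.Vec.Relation.Unary.Unique.Propositional using (Unique)
open import Function.Bundles using (_⇔_; mk⇔; module Equivalence)
open import Relation.Binary.PropositionalEquality.Core using (_≡_)
open import Relation.Nullary.Decidable
  using (Dec; map′; _×-dec_; _→-dec_; ¬?)
open import Relation.Nullary.Negation.Core using (¬_)
open import Relation.Unary using (Decidable)

private variable
  k n : ℕ

------------------------------------------------------------------------
-- Generalized patterns and their occurrences

-- Letters are numbered from 0.  `dash a` says whether a dash separates the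
-- letter in position a from the next one; its value at the last position is
-- never used.

record Pattern (k : ℕ) : Set where
  field
    letters : Permutation′ k
    dash    : Fin k → Bool

open Pattern

1-3-2 : Pattern 3
1-3-2 = record { letters = lift₀ (swap id) ; dash = λ _ → true }

-- The pattern 21-3-⋯-k, for 2 ≤ k (for k ≤ 1 the letters 2 and 1 do not both
-- exist, and the value is immaterial).

21-3-⋯- : ∀ k → Pattern k
21-3-⋯- k = record { letters = letters′ k ; dash = dash′ }
  where
  letters′ : ∀ k → Permutation′ k
  letters′ (suc (suc _)) = swap id
  letters′ _             = id

  dash′ : ∀ {k} → Fin k → Bool
  dash′ Fin.zero    = false
  dash′ (Fin.suc _) = true

IsOccurrence : Pattern k → Vec (Fin n) n → Vec (Fin n) k → Set
IsOccurrence τ π i =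
    (∀ a b → a Fin.< b → lookup i a Fin.< lookup i b)
  × (∀ a b → (letters τ ⟨$⟩ʳ a Fin.< letters τ ⟨$⟩ʳ b)
             ⇔ (lookup π (lookup i a) Fin.< lookup π (lookup i b)))
  × (∀ a b → toℕ b ≡ suc (toℕ a) → dash τ a ≡ false →
             toℕ (lookup i b) ≡ suc (toℕ (lookup i a)))

_⇔-dec_ : {A B : Set} → Dec A → Dec B → Dec (A ⇔ B)
a? ⇔-dec b? = map′ (uncurry mk⇔) (λ e → Equivalence.to e , Equivalence.from e)
                   ((a? →-dec b?) ×-dec (b? →-dec a?))

isOccurrence? : (τ : Pattern k) (π : Vec (Fin n) n) → Decidable (IsOccurrence τ π)
isOccurrence? τ π i =
        Fin.all? (λ a → Fin.all? λ b →
          (a Fin.<? b) →-dec (lookup i a Fin.<? lookup i b))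
  ×-dec Fin.all? (λ a → Fin.all? λ b →
          (letters τ ⟨$⟩ʳ a Fin.<? letters τ ⟨$⟩ʳ b)
          ⇔-dec (lookup π (lookup i a) Fin.<? lookup π (lookup i b)))
  ×-dec Fin.all? (λ a → Fin.all? λ b →
          (toℕ b ℕ.≟ suc (toℕ a)) →-dec ((dash τ a Bool.≟ false) →-dec
          (toℕ (lookup i b) ℕ.≟ suc (toℕ (lookup i a)))))

-- Every word of length l over the alphabet Fin n, listed exactly once.

words : ∀ n l → List (Vec (Fin n) l)
words n zero    = [] ∷ []
words n (suc l) = cartesianProductWith _∷_ (allFin n) (words n l)

occurrences : Pattern k → Vec (Fin n) n → ℕ
occurrences {k} {n} τ π = length (filter (isOccurrence? τ π) (words n k))

-- Permutations are in one-line notation: words of length n over Fin n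
-- without repeated letters.

Counted : Pattern k → ℕ → Vec (Fin n) n → Set
Counted τ r π = Unique π × occurrences 1-3-2 π ≡ 0 × occurrences τ π ≡ r

counted? : (τ : Pattern k) (r : ℕ) → Decidable (Counted {n = n} τ r)
counted? τ r π = allPairs? (λ a b → ¬? (a Fin.≟ b)) π
           ×-dec (occurrences 1-3-2 π ℕ.≟ 0)
           ×-dec (occurrences τ π ℕ.≟ r)

f : Pattern k → ℕ → ℕ → ℕ
f τ r n = length (filter (counted? τ r) (words n n))

------------------------------------------------------------------------
-- Chebyshev polynomials of the second kind

module Chebyshev {c ℓ} (R : RawRing c ℓ) where
  open RawRing R hiding (_≈_)

  U : ℕ → Carrier → Carrier
  U zero          t = 1#
  U (suc zero)    t = t + t
  U (suc (suc j)) t = (t + t) * U (suc j) t + - U j t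

-- The recurrence agrees with U_j(cos θ) sin θ = sin((j+1)θ): here c and s
-- stand for cos θ and sin θ, and the addition formulas define cos nθ, sin nθ.

module _ {a ℓ} (R : CommutativeRing a ℓ) where

  open CommutativeRing R hiding (zero)
  open Chebyshev rawRing
  open import Algebra.Solver.Ring.NaturalCoefficients.Default commutativeSemiring
    using (solve; _:=_; _:+_; _:*_)
  open import Algebra.Properties.Ring ring using (-‿distribˡ-*)
  open import Relation.Binary.Reasoning.Setoid setoid

  private
    expand : ∀ c s u v → ((c + c) * u + v) * s ≈ (c + c) * (u * s) + v * s
    expand = solve 4 (λ c s u v →
      ((c :+ c) :* u :+ v) :* s := (c :+ c) :* (u :* s) :+ v :* s) refl

    collect : ∀ c s S C p →
              (S * c + C * s) * c + (C * c + p) * s + S * (c * c + s * s) ≈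
              (c + c) * (S * c + C * s) + (p + S * s) * s
    collect = solve 5 (λ c s S C p →
      (S :* c :+ C :* s) :* c :+ (C :* c :+ p) :* s :+ S :* (c :* c :+ s :* s) :=
      (c :+ c) :* (S :* c :+ C :* s) :+ (p :+ S :* s) :* s) refl

  cos sin : Carrier → Carrier → ℕ → Carrier
  cos c s zero    = 1#
  cos c s (suc n) = cos c s n * c - sin c s n * s
  sin c s zero    = 0#
  sin c s (suc n) = sin c s n * c + cos c s n * s

  module _ (c s : Carrier) (c²+s²≈1 : c * c + s * s ≈ 1#) where

    sin-recurrence : ∀ n → (c + c) * sin c s (suc n) - sin c s n ≈
                           sin c s (suc (suc n))
    sin-recurrence n = begin
      (c + c) * S′ - S                            ≈⟨ +-congʳ sum ⟨
      (S″ + S) - S                                ≈⟨ +-assoc S″ S (- S) ⟩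
      S″ + (S - S)                                ≈⟨ +-congˡ (-‿inverseʳ S) ⟩
      S″ + 0#                                     ≈⟨ +-identityʳ S″ ⟩
      S″                                          ∎
      where
      S  = sin c s n
      C  = cos c s n
      S′ = sin c s (suc n)
      S″ = sin c s (suc (suc n))

      sum : S″ + S ≈ (c + c) * S′
      sum = begin
        S″ + S                                    ≈⟨ +-congˡ (*-identityʳ S) ⟨
        S″ + S * 1#                               ≈⟨ +-congˡ (*-congˡ c²+s²≈1) ⟨
        S″ + S * (c * c + s * s)                  ≈⟨ collect c s S C (- (S * s)) ⟩
        (c + c) * S′ + (- (S * s) + S * s) * s    ≈⟨ +-congˡ (*-congʳ (-‿inverseˡ (S * s))) ⟩
        (c + c) * S′ + 0# * s                     ≈⟨ +-congˡ (zeroˡ s) ⟩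
        (c + c) * S′ + 0#                         ≈⟨ +-identityʳ _ ⟩
        (c + c) * S′                              ∎

    U-sin : ∀ j → U j c * s ≈ sin c s (suc j)
    U-sin zero          = begin
      1# * s                                      ≈⟨ +-identityˡ _ ⟨
      0# + 1# * s                                 ≈⟨ +-congʳ (zeroˡ c) ⟨
      0# * c + 1# * s                             ∎
    U-sin (suc zero)    = begin
      (c + c) * s                                 ≈⟨ *-congˡ (*-identityˡ s) ⟨
      (c + c) * (1# * s)                          ≈⟨ *-congˡ (U-sin 0) ⟩
      (c + c) * sin c s 1                         ≈⟨ +-identityʳ _ ⟨
      (c + c) * sin c s 1 + 0#                    ≈⟨ +-congˡ (-‿inverseʳ 0#) ⟨
      (c + c) * sin c s 1 + (0# - 0#)             ≈⟨ +-congˡ (+-identityˡ (- 0#)) ⟩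
      (c + c) * sin c s 1 - 0#                    ≈⟨ sin-recurrence 0 ⟩
      sin c s 2                                   ∎
    U-sin (suc (suc j)) = begin
      ((c + c) * U (suc j) c - U j c) * s         ≈⟨ expand c s (U (suc j) c) (- U j c) ⟩
      (c + c) * (U (suc j) c * s) + - U j c * s   ≈⟨ +-congˡ (-‿distribˡ-* (U j c) s) ⟨
      (c + c) * (U (suc j) c * s) - U j c * s     ≈⟨ +-cong (*-congˡ (U-sin (suc j))) (-‿cong (U-sin j)) ⟩
      (c + c) * sin c s (suc (suc j)) - sin c s (suc j)  ≈⟨ sin-recurrence (suc j) ⟩
      sin c s (suc (suc (suc j)))                 ∎

------------------------------------------------------------------------
-- Formal power series over ℚ

Series : Set
Series = ℕ → ℚ

infix 4 _≗_
_≗_ : Series → Series → Set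
a ≗ b = ∀ n → a n ≡ b n

module _ where
  open import Algebra.Definitions.RawMonoid ℚ.+-0-rawMonoid using (sum)

  infixl 7 _⊛_
  _⊛_ : Series → Series → Series
  (a ⊛ b) n = sum {suc n} λ i → a (toℕ i) ℚ.* b (n ∸ toℕ i)

constant : ℚ → Series
constant q zero    = q
constant q (suc _) = 0ℚ

-- shift m a is Xᵐ a(X), and square-argument a is a(X²).

shift : ℕ → Series → Series
shift zero    a n       = a n
shift (suc m) a zero    = 0ℚ
shift (suc m) a (suc n) = shift m a n

square-argument : Series → Series
square-argument a zero          = a 0
square-argument a (suc zero)    = 0ℚ
square-argument a (suc (suc n)) = square-argument (λ m → a (suc m)) n

IsPolynomial : Series → Set
IsPolynomial a = ∃[ d ] ∀ n → d ℕ.< n → a n ≡ 0ℚ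

IsRational : Series → Set
IsRational a = ∃[ p ] ∃[ q ] IsPolynomial p × IsPolynomial q ×
                             ¬ (q ≗ constant 0ℚ) × q ⊛ a ≗ p

F : Pattern k → ℕ → Series
F τ r n = + f τ r n / 1

------------------------------------------------------------------------
-- Formal Laurent series in √x over ℚ

-- `s^- m · a` is the Laurent series (√x)⁻ᵐ a(√x).  Representations are not
-- unique, so equality compares them after clearing both denominators.

infix 8 s^-_·_
record Laurent : Set where
  constructor s^-_·_
  field
    order  : ℕ
    series : Series

laurent : RawRing 0ℓ 0ℓ
laurent = record
  { Carrier = Laurent
  ; _≈_     = λ { (s^- m · a) (s^- n · b) → shift n a ≗ shift m b }
  ; _+_     = λ { (s^- m · a) (s^- n · b) →
                  s^- (m ℕ.+ n) · λ i → shift n a i ℚ.+ shift m b i }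
  ; _*_     = λ { (s^- m · a) (s^- n · b) → s^- (m ℕ.+ n) · (a ⊛ b) }
  ; -_      = λ { (s^- m · a) → s^- m · λ i → ℚ.- a i }
  ; 0#      = s^- 0 · constant 0ℚ
  ; 1#      = s^- 0 · constant 1ℚ
  }

√x : Laurent
√x = s^- 0 · shift 1 (constant 1ℚ)

1/2√x : Laurent
1/2√x = s^- 1 · constant ½

-- A power series in x, read as a series in √x.

⟦_⟧ : Series → Laurent
⟦ a ⟧ = s^- 0 · square-argument a

open RawRing laurent using (_≈_; _*_; 1#; rawSemiring) public
open import Algebra.Definitions.RawSemiring rawSemiring using (_^_) public
open Chebyshev laurent using (U) public

-- A is the quotient of B by C: C is invertible and A = B · C⁻¹.

infix 4 _≈_÷_
_≈_÷_ : Laurent → Laurent → Laurent → Set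
A ≈ B ÷ C = ∃[ D ] C * D ≈ 1# × A ≈ B * D

module Submission where

-- Removing the maximum splits a 1-3-2-avoiding permutation into a left block lying entirely above
-- the right block, so these permutations are coded by binary trees. A descent sits at each node
-- with a right child; if that node is reached by d left steps, then exactly d larger letters follow,
-- in increasing order, giving C(d, k-2) occurrences of 21-3-⋯-k. Let P_d be the generating function of
-- trees hung at left depth d, with q marking occurrences; then P_d = 1 + x P_{d+1} P_d for d < k-2.
-- Modulo q^(k-1) no descent is allowed below depth k-2, so P_{k-2} is explicit, and P_0 is a
-- continued fraction, that is, a Möbius transformation in q whose entries are Chebyshev
-- polynomials. The coefficients of q are geometric, and the determinant of the transformation, a
-- power of x, appears in the coefficient of q.

open import Algebra.Bundles using (CommutativeRing)
open import Algebra.Bundles.Raw using (RawRing)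
import Algebra.Properties.CommutativeSemiring.Exp as Exp
import Algebra.Properties.Group as GroupProperties
import Algebra.Properties.Monoid.Mult as Mult
import Algebra.Properties.Ring as RingProperties
open import Data.Bool.Base using (if_then_else_; true; false)
open import Data.List.Base as List
  using (List; []; _∷_; _++_; map; filter; length; upTo; cartesianProductWith)
open import Data.Nat.Base as ℕ using (ℕ; zero; suc; _∸_; z≤n; s≤s; _≤_)
open import Data.Nat.Combinatorics using (_C_; nCk+nC[k+1]≡[n+1]C[k+1]; nCn≡1; k>n⇒nCk≡0)
import Data.Nat.Properties as ℕ
open import Data.Product.Base using (∃-syntax; _×_; _,_; proj₁; proj₂)
open import Data.Unit.Base using (⊤; tt)
open import Function.Base using (_∘_; case_of_)
open import Relation.Binary.PropositionalEquality as ≡ using (_≡_; _≢_)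
import Relation.Binary.Reasoning.Setoid as SetoidReasoning
open import Relation.Nullary.Decidable using (Dec; does; yes; no; _×-dec_)
open import Relation.Unary using (Decidable)

-- Power series

-- The bound on r decides the method. With j = k - 2, a descent at left depth d contributes `d C j`:
-- nothing for d < j, exactly 1 for d = j, at least j + 1 for d > j. Modulo q^(j+1) the variable q
-- therefore enters at the single level d = j, and only to the first power; for larger r the deeper
-- descents would count too. The truncation is put into the equality of the coefficient ring, so
-- that the vanishing of `Q ^ w` for w > j is an equation of that ring. The algebra avoids both
-- fractions and √x: the Chebyshev polynomials are replaced by polynomials `u` in x, and Möbius
-- transformations are cross-multiplied. √x returns only at the end, where each Laurent expression,
-- whose representation is not unique, is tied to a power series by clearing its pole. On the
-- combinatorial side the larger letters that follow a descent are never listed. Appending a maximum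
-- to a block changes the counts by Pascal's rule, and so does hanging a subtree one left step
-- deeper; the two recursions are matched.

module PowerSeries {c ℓ} (R : CommutativeRing c ℓ)
  (B : ℕ → Set) (B-down : ∀ {m n} → m ℕ.≤ n → B n → B m) where

  open CommutativeRing R hiding (zero)
  open import Algebra.Solver.Ring.NaturalCoefficients.Default commutativeSemiring
    using (solve; _:=_; _:+_; _:*_; con)
  open SetoidReasoning setoid

  tail : (ℕ → Carrier) → ℕ → Carrier
  tail a n = a (suc n)

  const : Carrier → ℕ → Carrier
  const r zero    = r
  const r (suc _) = 0#

  shift1 : (ℕ → Carrier) → ℕ → Carrier
  shift1 a zero    = 0#
  shift1 a (suc n) = a n

  infixl 7 _⊛_
  _⊛_ : (ℕ → Carrier) → (ℕ → Carrier) → ℕ → Carrier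
  (a ⊛ b) zero    = a 0 * b 0
  (a ⊛ b) (suc n) = a 0 * b (suc n) + (tail a ⊛ b) n

  X : ℕ → Carrier
  X = shift1 (const 1#)

  -- Coefficient `n` of a product sees only coefficients up to `n` of the factors. This makes
  -- truncated equality a congruence, and later lets sums over trees of bounded height stabilise.
  ⊛-cong-≤ : ∀ n {a a′ b b′} → (∀ i → i ℕ.≤ n → a i ≈ a′ i) → (∀ i → i ℕ.≤ n → b i ≈ b′ i) →
             (a ⊛ b) n ≈ (a′ ⊛ b′) n
  ⊛-cong-≤ zero    p q = *-cong (p 0 z≤n) (q 0 z≤n)
  ⊛-cong-≤ (suc n) p q = +-cong (*-cong (p 0 z≤n) (q (suc n) ℕ.≤-refl))
    (⊛-cong-≤ n (λ i i≤n → p (suc i) (s≤s i≤n)) (λ i i≤n → q i (ℕ.m≤n⇒m≤1+n i≤n)))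

  ⊛-cong-≗ : ∀ {a a′ b b′} → (∀ i → a i ≈ a′ i) → (∀ i → b i ≈ b′ i) → ∀ n →
             (a ⊛ b) n ≈ (a′ ⊛ b′) n
  ⊛-cong-≗ p q n = ⊛-cong-≤ n (λ i _ → p i) (λ i _ → q i)

  -- `⊛` recurses on its left factor; peeling the right factor as well is what commutativity needs.
  ⊛-last : ∀ a b n → (a ⊛ b) (suc n) ≈ a (suc n) * b 0 + (a ⊛ tail b) n
  ⊛-last a b zero    = solve 4 (λ a₀ a₁ b₀ b₁ → a₀ :* b₁ :+ a₁ :* b₀ := a₁ :* b₀ :+ a₀ :* b₁)
    refl (a 0) (a 1) (b 0) (b 1)
  ⊛-last a b (suc n) = begin
    a 0 * b (suc (suc n)) + (tail a ⊛ b) (suc n)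
      ≈⟨ +-congˡ (⊛-last (tail a) b n) ⟩
    a 0 * b (suc (suc n)) + (a (suc (suc n)) * b 0 + (tail a ⊛ tail b) n)
      ≈⟨ solve 3 (λ p q r → p :+ (q :+ r) := q :+ (p :+ r)) refl _ _ _ ⟩
    a (suc (suc n)) * b 0 + (a 0 * b (suc (suc n)) + (tail a ⊛ tail b) n) ∎

  ⊛-comm : ∀ a b n → (a ⊛ b) n ≈ (b ⊛ a) n
  ⊛-comm a b zero    = *-comm (a 0) (b 0)
  ⊛-comm a b (suc n) = begin
    a 0 * b (suc n) + (tail a ⊛ b) n  ≈⟨ +-cong (*-comm (a 0) (b (suc n))) (⊛-comm (tail a) b n) ⟩
    b (suc n) * a 0 + (b ⊛ tail a) n  ≈⟨ ⊛-last b a n ⟨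
    (b ⊛ a) (suc n)                   ∎

  ⊛-distribʳ : ∀ c a b n → ((λ i → a i + b i) ⊛ c) n ≈ (a ⊛ c) n + (b ⊛ c) n
  ⊛-distribʳ c a b zero    = distribʳ (c 0) (a 0) (b 0)
  ⊛-distribʳ c a b (suc n) = begin
    (a 0 + b 0) * c (suc n) + ((λ i → a (suc i) + b (suc i)) ⊛ c) n
      ≈⟨ +-congˡ (⊛-distribʳ c (tail a) (tail b) n) ⟩
    (a 0 + b 0) * c (suc n) + ((tail a ⊛ c) n + (tail b ⊛ c) n)
      ≈⟨ solve 5 (λ a b c p q → (a :+ b) :* c :+ (p :+ q) := (a :* c :+ p) :+ (b :* c :+ q))
           refl (a 0) (b 0) (c (suc n)) _ _ ⟩
    (a ⊛ c) (suc n) + (b ⊛ c) (suc n) ∎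

  ⊛-scaleˡ : ∀ r a b n → ((λ i → r * a i) ⊛ b) n ≈ r * (a ⊛ b) n
  ⊛-scaleˡ r a b zero    = *-assoc r (a 0) (b 0)
  ⊛-scaleˡ r a b (suc n) = begin
    (r * a 0) * b (suc n) + ((λ i → r * a (suc i)) ⊛ b) n
      ≈⟨ +-congˡ (⊛-scaleˡ r (tail a) b n) ⟩
    (r * a 0) * b (suc n) + r * (tail a ⊛ b) n
      ≈⟨ solve 4 (λ r a b p → (r :* a) :* b :+ r :* p := r :* (a :* b :+ p)) refl r (a 0) (b (suc n)) _ ⟩
    r * (a ⊛ b) (suc n) ∎

  ⊛-zeroˡ : ∀ b n → ((λ _ → 0#) ⊛ b) n ≈ 0#
  ⊛-zeroˡ b zero    = zeroˡ (b 0)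
  ⊛-zeroˡ b (suc n) = trans (+-cong (zeroˡ (b (suc n))) (⊛-zeroˡ b n)) (+-identityʳ 0#)

  ⊛-assoc : ∀ a b c n → ((a ⊛ b) ⊛ c) n ≈ (a ⊛ (b ⊛ c)) n
  ⊛-assoc a b c zero    = *-assoc (a 0) (b 0) (c 0)
  ⊛-assoc a b c (suc n) = begin
    a 0 * b 0 * c (suc n) + ((λ i → a 0 * b (suc i) + (tail a ⊛ b) i) ⊛ c) n
      ≈⟨ +-congˡ (⊛-distribʳ c (λ i → a 0 * b (suc i)) (tail a ⊛ b) n) ⟩
    a 0 * b 0 * c (suc n) + (((λ i → a 0 * b (suc i)) ⊛ c) n + ((tail a ⊛ b) ⊛ c) n)
      ≈⟨ +-congˡ (+-cong (⊛-scaleˡ (a 0) (tail b) c n) (⊛-assoc (tail a) b c n)) ⟩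
    a 0 * b 0 * c (suc n) + (a 0 * (tail b ⊛ c) n + (tail a ⊛ (b ⊛ c)) n)
      ≈⟨ solve 5 (λ a b c p q → a :* b :* c :+ (a :* p :+ q) := a :* (b :* c :+ p) :+ q)
           refl (a 0) (b 0) (c (suc n)) _ _ ⟩
    a 0 * (b 0 * c (suc n) + (tail b ⊛ c) n) + (tail a ⊛ (b ⊛ c)) n ∎

  const-⊛ : ∀ r a n → (const r ⊛ a) n ≈ r * a n
  const-⊛ r a zero    = refl
  const-⊛ r a (suc n) = trans (+-congˡ (⊛-zeroˡ a n)) (+-identityʳ _)

  X-⊛ : ∀ a n → (X ⊛ a) n ≈ shift1 a n
  X-⊛ a zero    = zeroˡ _
  X-⊛ a (suc n) = begin
    0# * a (suc n) + (const 1# ⊛ a) n  ≈⟨ +-cong (zeroˡ _) (const-⊛ 1# a n) ⟩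
    0# + 1# * a n                      ≈⟨ solve 1 (λ x → con 0 :+ con 1 :* x := x) refl (a n) ⟩
    a n                                ∎

  infix 4 _≋_
  -- Equality inspects only the indices in `B`: all of them for ordinary series, those up to `j` for
  -- the quotient by the power j + 1 of the variable. Downward closure of `B` corresponds to this
  -- being a quotient by an ideal.
  _≋_ : (ℕ → Carrier) → (ℕ → Carrier) → Set ℓ
  a ≋ b = ∀ n → B n → a n ≈ b n

  power-series : CommutativeRing c ℓ
  power-series = record
    { Carrier = ℕ → Carrier
    ; _≈_     = _≋_
    ; _+_     = λ a b n → a n + b n
    ; _*_     = _⊛_
    ; -_      = λ a n → - a n
    ; 0#      = λ _ → 0#
    ; 1#      = const 1#
    ; isCommutativeRing = record
      { isRing = record
        { +-isAbelianGroup = record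
          { isGroup = record
            { isMonoid = record
              { isSemigroup = record
                { isMagma = record
                  { isEquivalence = record
                    { refl  = λ _ _ → refl
                    ; sym   = λ p n Bn → sym (p n Bn)
                    ; trans = λ p q n Bn → trans (p n Bn) (q n Bn)
                    }
                  ; ∙-cong = λ p q n Bn → +-cong (p n Bn) (q n Bn)
                  }
                ; assoc = λ a b c n _ → +-assoc (a n) (b n) (c n)
                }
              ; identity = (λ a n _ → +-identityˡ (a n)) , (λ a n _ → +-identityʳ (a n))
              }
            ; inverse = (λ a n _ → -‿inverseˡ (a n)) , (λ a n _ → -‿inverseʳ (a n))
            ; ⁻¹-cong = λ p n Bn → -‿cong (p n Bn)
            }
          ; comm = λ a b n _ → +-comm (a n) (b n)
          }
        ; *-cong     = λ p q n Bn →
            ⊛-cong-≤ n (λ i i≤n → p i (B-down i≤n Bn)) (λ i i≤n → q i (B-down i≤n Bn))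
        ; *-assoc    = λ a b c n _ → ⊛-assoc a b c n
        ; *-identity = (λ a n _ → const-1-⊛ a n)
                     , (λ a n _ → trans (⊛-comm a (const 1#) n) (const-1-⊛ a n))
        ; distrib    = (λ c a b n _ → ⊛-distribˡ c a b n) , (λ c a b n _ → ⊛-distribʳ c a b n)
        }
      ; *-comm = λ a b n _ → ⊛-comm a b n
      }
    }
    where
    const-1-⊛ : ∀ a n → (const 1# ⊛ a) n ≈ a n
    const-1-⊛ a n = trans (const-⊛ 1# a n) (*-identityˡ (a n))

    ⊛-distribˡ : ∀ c a b n → (c ⊛ (λ i → a i + b i)) n ≈ (c ⊛ a) n + (c ⊛ b) n
    ⊛-distribˡ c a b n = begin
      (c ⊛ (λ i → a i + b i)) n  ≈⟨ ⊛-comm c (λ i → a i + b i) n ⟩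
      ((λ i → a i + b i) ⊛ c) n  ≈⟨ ⊛-distribʳ c a b n ⟩
      (a ⊛ c) n + (b ⊛ c) n      ≈⟨ +-cong (⊛-comm a c n) (⊛-comm b c n) ⟩
      (c ⊛ a) n + (c ⊛ b) n      ∎

-- Reduced Chebyshev polynomials and the Möbius form of the continued fraction.

module ReducedChebyshev {c ℓ} (R : CommutativeRing c ℓ) (x : CommutativeRing.Carrier R) where

  open CommutativeRing R hiding (zero)
  open Exp commutativeSemiring using (_^_)
  open import Algebra.Solver.Ring.NaturalCoefficients.Default commutativeSemiring
    using (solve; _:=_; _:+_; _:*_; con)
  open SetoidReasoning setoid
  open GroupProperties +-group using () renaming (∙-cancelʳ to +-cancelʳ)

  -- U_j(1/(2√x)) = x^(-j/2) u j
  u : ℕ → Carrier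
  u zero          = 1#
  u (suc zero)    = 1#
  u (suc (suc j)) = u (suc j) - x * u j

  u-recurrence : ∀ j → u (suc (suc j)) + x * u j ≈ u (suc j)
  u-recurrence j = begin
    (u (suc j) - x * u j) + x * u j    ≈⟨ +-assoc _ _ _ ⟩
    u (suc j) + (- (x * u j) + x * u j) ≈⟨ +-congˡ (-‿inverseˡ _) ⟩
    u (suc j) + 0#                     ≈⟨ +-identityʳ _ ⟩
    u (suc j)                          ∎

  -- A Cassini identity. Multiplied by x it is the determinant of the transformation in `Möbius`,
  -- namely x^(j+2).
  u-cassini : ∀ j → u (suc j) * u (suc j) ≈ u j * u (suc (suc j)) + x ^ suc j
  u-cassini zero    = begin
    1# * 1#                          ≈⟨ *-congˡ (u-recurrence 0) ⟨
    1# * (u 2 + x * 1#)              ≈⟨ expand ⟩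
    1# * u 2 + x ^ 1                 ∎
    where
    expand = solve 2 (λ u₂ x → con 1 :* (u₂ :+ x :* con 1) := con 1 :* u₂ :+ x :* con 1) refl (u 2) x
  -- Adding `x * (u j * u₂)` to both sides allows the recurrence to be used in its additive form,
  -- with no subtraction.
  u-cassini (suc j) = +-cancelʳ (x * (u j * u₂)) _ _ (begin
    u₂ * u₂ + x * (u j * u₂)         ≈⟨ solve 3 (λ a b x → a :* a :+ x :* (b :* a) := a :* (a :+ x :* b)) refl u₂ (u j) x ⟩
    u₂ * (u₂ + x * u j)              ≈⟨ *-congˡ (u-recurrence j) ⟩
    u₂ * u₁                          ≈⟨ *-congʳ (u-recurrence (suc j)) ⟨
    (u₃ + x * u₁) * u₁               ≈⟨ solve 3 (λ a b x → (a :+ x :* b) :* b := a :* b :+ x :* (b :* b)) refl u₃ u₁ x ⟩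
    u₃ * u₁ + x * (u₁ * u₁)          ≈⟨ +-congˡ (*-congˡ (u-cassini j)) ⟩
    u₃ * u₁ + x * (u j * u₂ + x ^ suc j)
      ≈⟨ solve 5 (λ a b c x y → a :* b :+ x :* (c :+ y) := b :* a :+ x :* y :+ x :* c) refl u₃ u₁ (u j * u₂) x (x ^ suc j) ⟩
    u₁ * u₃ + x ^ suc (suc j) + x * (u j * u₂) ∎)
    where
    u₁ = u (suc j)
    u₂ = u (suc (suc j))
    u₃ = u (suc (suc (suc j)))

  -- Fⱼ = (uⱼ₊₁ - x uⱼ q) / (uⱼ₊₂ - x uⱼ₊₁ q), with the subtractions moved to the other side.
  Möbius : Carrier → ℕ → Carrier → Set ℓ
  Möbius q j F = u (suc (suc j)) * F + x * u j * q ≈ u (suc j) + x * u (suc j) * q * F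

  -- The innermost level of the continued fraction. The first hypothesis says that `y` is 1/(1 - x),
  -- which is the inverse of `u 2`; multiplying the equation for `g` by `u 2` removes `y`.
  möbius-zero : ∀ {q y g} → y ≈ 1# + x * y → g ≈ x * y * (1# + q * g) → Möbius q 0 (1# + g)
  möbius-zero {q} {y} {g} y-eq g-eq = begin
    u 2 * (1# + g) + x * 1# * q               ≈⟨ +-congʳ (trans (distribˡ _ _ _) (+-congˡ u₂g)) ⟩
    (u 2 * 1# + x * (1# + q * g)) + x * 1# * q
      ≈⟨ solve 4 (λ u₂ x q g → (u₂ :* con 1 :+ x :* (con 1 :+ q :* g)) :+ x :* con 1 :* q :=
                              (u₂ :+ x :* con 1) :+ x :* con 1 :* q :* (con 1 :+ g)) refl (u 2) x q g ⟩
    (u 2 + x * 1#) + x * 1# * q * (1# + g)    ≈⟨ +-congʳ (u-recurrence 0) ⟩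
    1# + x * 1# * q * (1# + g)                ∎
    where
    u₂y : u 2 * y ≈ 1#
    u₂y = +-cancelʳ (x * y) _ _ (begin
      u 2 * y + x * y        ≈⟨ solve 3 (λ u₂ x y → u₂ :* y :+ x :* y := (u₂ :+ x :* con 1) :* y) refl (u 2) x y ⟩
      (u 2 + x * 1#) * y     ≈⟨ *-congʳ (u-recurrence 0) ⟩
      1# * y                 ≈⟨ *-identityˡ y ⟩
      y                      ≈⟨ y-eq ⟩
      1# + x * y             ∎)

    u₂g : u 2 * g ≈ x * (1# + q * g)
    u₂g = begin
      u 2 * g                        ≈⟨ *-congˡ g-eq ⟩
      u 2 * (x * y * (1# + q * g))   ≈⟨ solve 4 (λ a b c d → a :* (b :* c :* d) := a :* c :* (b :* d)) refl _ _ _ _ ⟩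
      u 2 * y * (x * (1# + q * g))   ≈⟨ *-congʳ u₂y ⟩
      1# * (x * (1# + q * g))        ≈⟨ *-identityˡ _ ⟩
      x * (1# + q * g)               ∎

  -- Here G = 1/(1 - xF). If F = A/B then G = B/(B - xA): the old denominator becomes the numerator,
  -- and the new denominator is produced by the Chebyshev recurrence.
  möbius-suc : ∀ {q} j {F G} → Möbius q j F → G ≈ 1# + x * F * G → Möbius q (suc j) G
  möbius-suc {q} j {F} {G} F-eq G-eq = +-cancelʳ z _ _ (begin
    u₃ * G + x * u₁ * q + z
      ≈⟨ solve 6 (λ u₀ u₁ u₃ x q G → u₃ :* G :+ x :* u₁ :* q :+ (x :* u₁ :* G :+ x :* G :* (x :* u₀ :* q)) :=
                    (u₃ :+ x :* u₁) :* G :+ x :* u₁ :* q :+ x :* G :* (x :* u₀ :* q)) refl u₀ u₁ u₃ x q G ⟩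
    (u₃ + x * u₁) * G + x * u₁ * q + x * G * (x * u₀ * q)
      ≈⟨ +-congʳ (+-congʳ (trans (*-congʳ (u-recurrence (suc j))) (*-congˡ G-eq))) ⟩
    u₂ * (1# + x * F * G) + x * u₁ * q + x * G * (x * u₀ * q)
      ≈⟨ solve 7 (λ u₀ u₁ u₂ x q F G → u₂ :* (con 1 :+ x :* F :* G) :+ x :* u₁ :* q :+ x :* G :* (x :* u₀ :* q) :=
                    u₂ :+ x :* u₁ :* q :+ x :* G :* (u₂ :* F :+ x :* u₀ :* q)) refl u₀ u₁ u₂ x q F G ⟩
    u₂ + x * u₁ * q + x * G * (u₂ * F + x * u₀ * q)
      ≈⟨ +-congˡ (*-congˡ F-eq) ⟩
    u₂ + x * u₁ * q + x * G * (u₁ + x * u₁ * q * F)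
      ≈⟨ solve 6 (λ u₁ u₂ x q F G → u₂ :+ x :* u₁ :* q :+ x :* G :* (u₁ :+ x :* u₁ :* q :* F) :=
                    u₂ :+ x :* u₁ :* q :* (con 1 :+ x :* F :* G) :+ x :* G :* u₁) refl u₁ u₂ x q F G ⟩
    u₂ + x * u₁ * q * (1# + x * F * G) + x * G * u₁
      ≈⟨ +-congʳ (+-congˡ (*-cong (*-congʳ (*-congˡ (u-recurrence j))) G-eq)) ⟨
    u₂ + x * (u₂ + x * u₀) * q * G + x * G * u₁
      ≈⟨ solve 6 (λ u₀ u₁ u₂ x q G → u₂ :+ x :* (u₂ :+ x :* u₀) :* q :* G :+ x :* G :* u₁ :=
                    u₂ :+ x :* u₂ :* q :* G :+ (x :* u₁ :* G :+ x :* G :* (x :* u₀ :* q))) refl u₀ u₁ u₂ x q G ⟩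
    u₂ + x * u₂ * q * G + z ∎)
    where
    u₀ = u j
    u₁ = u (suc j)
    u₂ = u (suc (suc j))
    u₃ = u (suc (suc (suc j)))
    -- `z` holds the two terms that would otherwise be subtracted: the first completes `u₃ * G` to
    -- `u₂ * G`, the second completes `u₂ * F` to the left side of `F-eq`.
    z  = x * u₁ * G + x * G * (x * u₀ * q)

  module _ (j : ℕ) (F : ℕ → Carrier) (F₀ : u (suc (suc j)) * F 0 ≈ u (suc j)) where

    private
      v = u (suc (suc j))

    -- From `F 1` on, the coefficients form a geometric progression with ratio x u_(j+1)/v. Its
    -- first term is x (u_(j+1)² - u_j v)/v², and `u-cassini` turns this into x^(j+2)/v². The ratio
    -- is required only for `i < r` because the equations are known only up to the truncation order.
    möbius-coefficient : u (suc (suc j)) * F 1 + x * u j ≈ x * u (suc j) * F 0 → ∀ r →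
      (∀ i → i ℕ.< r → u (suc (suc j)) * F (suc (suc i)) ≈ x * u (suc j) * F (suc i)) →
      v ^ suc (suc r) * F (suc r) ≈ x ^ r * u (suc j) ^ r * x ^ suc (suc j)
    möbius-coefficient F₁ zero    _   = +-cancelʳ (x * u j * v) _ _ (begin
      v * (v * 1#) * F 1 + x * u j * v    ≈⟨ solve 3 (λ v f w → v :* (v :* con 1) :* f :+ w :* v := v :* (v :* f :+ w)) refl v (F 1) (x * u j) ⟩
      v * (v * F 1 + x * u j)             ≈⟨ *-congˡ F₁ ⟩
      v * (x * u (suc j) * F 0)           ≈⟨ solve 4 (λ v x u f → v :* (x :* u :* f) := x :* u :* (v :* f)) refl _ _ _ _ ⟩
      x * u (suc j) * (v * F 0)           ≈⟨ *-congˡ F₀ ⟩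
      x * u (suc j) * u (suc j)           ≈⟨ *-assoc _ _ _ ⟩
      x * (u (suc j) * u (suc j))         ≈⟨ *-congˡ (u-cassini j) ⟩
      x * (u j * v + x ^ suc j)           ≈⟨ solve 4 (λ x u v y → x :* (u :* v :+ y) := con 1 :* con 1 :* (x :* y) :+ x :* u :* v) refl x (u j) v (x ^ suc j) ⟩
      1# * 1# * (x * x ^ suc j) + x * u j * v ∎)
    möbius-coefficient F₁ (suc r) Fᵣ = begin
      v * v ^ suc (suc r) * F (suc (suc r))     ≈⟨ solve 3 (λ a b c → a :* b :* c := b :* (a :* c)) refl _ _ _ ⟩
      v ^ suc (suc r) * (v * F (suc (suc r)))   ≈⟨ *-congˡ (Fᵣ r (s≤s ℕ.≤-refl)) ⟩
      v ^ suc (suc r) * (x * u (suc j) * F (suc r))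
        ≈⟨ solve 4 (λ a b c d → a :* (b :* c :* d) := b :* c :* (a :* d)) refl _ _ _ _ ⟩
      x * u (suc j) * (v ^ suc (suc r) * F (suc r))
        ≈⟨ *-congˡ (möbius-coefficient F₁ r λ i i<r → Fᵣ i (ℕ.m≤n⇒m≤1+n i<r)) ⟩
      x * u (suc j) * (x ^ r * u (suc j) ^ r * x ^ suc (suc j))
        ≈⟨ solve 5 (λ a b c d e → a :* b :* (c :* d :* e) := a :* c :* (b :* d) :* e) refl _ _ _ _ _ ⟩
      x ^ suc r * u (suc j) ^ suc r * x ^ suc (suc j) ∎

-- Cross-multiplied identities for quotients.

module Quotients {c ℓ} (R : CommutativeRing c ℓ) where

  open CommutativeRing R renaming (_≈_ to _≃_; _*_ to _∙_; 1# to 1ᵣ)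
  open import Algebra.Solver.Ring.NaturalCoefficients.Default commutativeSemiring
    using (solve; _:=_; _:+_; _:*_)
  open SetoidReasoning setoid

  cancel-unit : ∀ {a b x y δ γ} → y ∙ b ≃ x ∙ γ → γ ∙ δ ≃ 1ᵣ → a ≃ y ∙ δ → b ∙ a ≃ x
  cancel-unit {a} {b} {x} {y} {δ} {γ} yb γδ a≃ = begin
    b ∙ a          ≈⟨ *-congˡ a≃ ⟩
    b ∙ (y ∙ δ)    ≈⟨ solve 3 (λ b y δ → b :* (y :* δ) := y :* b :* δ) refl b y δ ⟩
    y ∙ b ∙ δ      ≈⟨ *-congʳ yb ⟩
    x ∙ γ ∙ δ      ≈⟨ *-assoc x γ δ ⟩
    x ∙ (γ ∙ δ)    ≈⟨ *-congˡ γδ ⟩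
    x ∙ 1ᵣ         ≈⟨ *-identityʳ x ⟩
    x              ∎

  -- Read b = xβ/y, a = zβ/γ and d = yz/γ. In the application `x`, `y`, `z` are powers of the
  -- variable, and inverting γ alone suffices.
  quotient : ∀ {a b d x y z β γ δ} → y ∙ b ≃ x ∙ β → γ ∙ δ ≃ 1ᵣ → γ ∙ a ≃ z ∙ β → d ≃ y ∙ z ∙ δ → x ∙ a ≃ b ∙ d
  quotient {a} {b} {d} {x} {y} {z} {β} {γ} {δ} yb γδ γa d≃ = begin
    x ∙ a                  ≈⟨ *-congˡ (*-identityʳ a) ⟨
    x ∙ (a ∙ 1ᵣ)           ≈⟨ *-congˡ (*-congˡ γδ) ⟨
    x ∙ (a ∙ (γ ∙ δ))      ≈⟨ solve 4 (λ x a γ δ → x :* (a :* (γ :* δ)) := x :* (γ :* a) :* δ) refl x a γ δ ⟩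
    x ∙ (γ ∙ a) ∙ δ        ≈⟨ *-congʳ (*-congˡ γa) ⟩
    x ∙ (z ∙ β) ∙ δ        ≈⟨ solve 4 (λ x z β δ → x :* (z :* β) :* δ := (x :* β) :* (z :* δ)) refl x z β δ ⟩
    (x ∙ β) ∙ (z ∙ δ)      ≈⟨ *-congʳ yb ⟨
    (y ∙ b) ∙ (z ∙ δ)      ≈⟨ solve 4 (λ y b z δ → (y :* b) :* (z :* δ) := b :* (y :* z :* δ)) refl y b z δ ⟩
    b ∙ (y ∙ z ∙ δ)        ≈⟨ *-congˡ d≃ ⟨
    b ∙ d                  ∎

  *-interchange : ∀ {x y a b c d e g} → x ∙ a ≃ c ∙ e → y ∙ b ≃ d ∙ g → (x ∙ y) ∙ (a ∙ b) ≃ (c ∙ d) ∙ (e ∙ g)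
  *-interchange {x} {y} {a} {b} {c} {d} {e} {g} p q = begin
    (x ∙ y) ∙ (a ∙ b)  ≈⟨ solve 4 (λ x y a b → (x :* y) :* (a :* b) := (x :* a) :* (y :* b)) refl x y a b ⟩
    (x ∙ a) ∙ (y ∙ b)  ≈⟨ *-cong p q ⟩
    (c ∙ e) ∙ (d ∙ g)  ≈⟨ solve 4 (λ c d e g → (c :* e) :* (d :* g) := (c :* d) :* (e :* g)) refl c d e g ⟩
    (c ∙ d) ∙ (e ∙ g)  ∎

  common-denominator : ∀ {x a b c d m n} → x ∙ a ≃ m ∙ c → x ∙ b ≃ n ∙ d → x ∙ (n ∙ a + m ∙ b) ≃ m ∙ n ∙ (c + d)
  common-denominator {x} {a} {b} {c} {d} {m} {n} p q = begin
    x ∙ (n ∙ a + m ∙ b)              ≈⟨ solve 5 (λ x a b m n → x :* (n :* a :+ m :* b) := n :* (x :* a) :+ m :* (x :* b)) refl x a b m n ⟩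
    n ∙ (x ∙ a) + m ∙ (x ∙ b)        ≈⟨ +-cong (*-congˡ p) (*-congˡ q) ⟩
    n ∙ (m ∙ c) + m ∙ (n ∙ d)        ≈⟨ solve 4 (λ m n c d → n :* (m :* c) :+ m :* (n :* d) := m :* n :* (c :+ d)) refl m n c d ⟩
    m ∙ n ∙ (c + d)                  ∎
  regroup : ∀ a b c → (a ∙ a) ∙ b ∙ (c ∙ c) ≃ (a ∙ (c ∙ c)) ∙ (a ∙ b)
  regroup = solve 3 (λ a b c → (a :* a) :* b :* (c :* c) := (a :* (c :* c)) :* (a :* b)) refl

-- Generating functions of trees

data Tree : Set where
  leaf : Tree
  node : Tree → Tree → Tree

size : Tree → ℕ
size leaf       = 0
size (node l r) = suc (size l ℕ.+ size r)

unless-leaf : Tree → ℕ → ℕ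
unless-leaf leaf       w = 0
unless-leaf (node _ _) w = w

-- A node with a right child, reached from the root by d left steps (and any number of right
-- steps), contributes d C j.
weight : ℕ → ℕ → Tree → ℕ
weight j d leaf       = 0
weight j d (node l r) = weight j (suc d) l ℕ.+ (unless-leaf r (d C j) ℕ.+ weight j d r)

-- A bound on the height makes this list a full Cartesian product, so that weighted sums over it
-- factor; a bound on the size would couple the two subtrees.
nodes-of-height≤ : ℕ → List Tree
nodes-of-height≤ zero    = []
nodes-of-height≤ (suc h) = cartesianProductWith node (leaf ∷ nodes-of-height≤ h) (leaf ∷ nodes-of-height≤ h)

trees-of-height≤ : ℕ → List Tree
trees-of-height≤ h = leaf ∷ nodes-of-height≤ h

1≤[k+d]Ck : ∀ d k → 1 ℕ.≤ (k ℕ.+ d) C k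
1≤[k+d]Ck zero    k       rewrite ℕ.+-identityʳ k | nCn≡1 k = ℕ.≤-refl
1≤[k+d]Ck (suc d) zero    = ℕ.≤-refl
1≤[k+d]Ck (suc d) (suc k) = begin
  1                                                        ≤⟨ 1≤[k+d]Ck (suc d) k ⟩
  (k ℕ.+ suc d) C k                                        ≤⟨ ℕ.m≤m+n _ _ ⟩
  (k ℕ.+ suc d) C k ℕ.+ (k ℕ.+ suc d) C suc k              ≡⟨ nCk+nC[k+1]≡[n+1]C[k+1] (k ℕ.+ suc d) k ⟩
  suc (k ℕ.+ suc d) C suc k                                ∎
  where open ℕ.≤-Reasoning

-- With `k` as j, this says that one descent below left depth j already yields more than j
-- occurrences, so it is invisible modulo q^(j+1). Pascal's rule adds at least 1 at each step.
k<nCk : ∀ d k → suc k ℕ.≤ suc (k ℕ.+ d) C k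
k<nCk d zero    = ℕ.≤-refl
k<nCk d (suc k) = begin
  suc (suc k)                                              ≡⟨ ℕ.+-comm 1 (suc k) ⟩
  suc k ℕ.+ 1                                              ≤⟨ ℕ.+-mono-≤ (k<nCk d k) (1≤[k+d]Ck d (suc k)) ⟩
  suc (k ℕ.+ d) C k ℕ.+ suc (k ℕ.+ d) C suc k              ≡⟨ nCk+nC[k+1]≡[n+1]C[k+1] (suc (k ℕ.+ d)) k ⟩
  suc (suc k ℕ.+ d) C suc k                                ∎
  where open ℕ.≤-Reasoning

-- Weighted sums over lists and trees.

module ListSum {c ℓ} (R : CommutativeRing c ℓ) where

  open CommutativeRing R hiding (zero)
  open import Algebra.Solver.Ring.NaturalCoefficients.Default commutativeSemiring
    using (solve; _:=_; _:+_; _:*_)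
  open SetoidReasoning setoid

  Σ : ∀ {A : Set} → List A → (A → Carrier) → Carrier
  Σ []       h = 0#
  Σ (x ∷ xs) h = h x + Σ xs h

  Σ-++ : ∀ {A : Set} (xs ys : List A) h → Σ (xs ++ ys) h ≈ Σ xs h + Σ ys h
  Σ-++ []       ys h = sym (+-identityˡ _)
  Σ-++ (x ∷ xs) ys h = trans (+-congˡ (Σ-++ xs ys h)) (sym (+-assoc _ _ _))

  Σ-cartesianProductWith : ∀ {A B D : Set} (f : A → B → D) xs ys {h r p q} →
    (∀ x y → h (f x y) ≈ r * p x * q y) →
    Σ (cartesianProductWith f xs ys) h ≈ r * Σ xs p * Σ ys q
  Σ-cartesianProductWith f []       ys {r = r} {q = q} eq = sym (begin
    r * 0# * Σ ys q   ≈⟨ *-congʳ (zeroʳ r) ⟩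
    0# * Σ ys q       ≈⟨ zeroˡ _ ⟩
    0#                ∎)
  Σ-cartesianProductWith f (x ∷ xs) ys {h} {r} {p} {q} eq = begin
    Σ (map (f x) ys ++ cartesianProductWith f xs ys) h            ≈⟨ Σ-++ (map (f x) ys) _ h ⟩
    Σ (map (f x) ys) h + Σ (cartesianProductWith f xs ys) h
      ≈⟨ +-cong (row ys) (Σ-cartesianProductWith f xs ys eq) ⟩
    r * p x * Σ ys q + r * Σ xs p * Σ ys q
      ≈⟨ solve 4 (λ r a b c → r :* a :* c :+ r :* b :* c := r :* (a :+ b) :* c) refl r (p x) (Σ xs p) (Σ ys q) ⟩
    r * (p x + Σ xs p) * Σ ys q                                   ∎
    where
    row : ∀ ys → Σ (map (f x) ys) h ≈ r * p x * Σ ys q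
    row []       = sym (zeroʳ _)
    row (y ∷ ys) = trans (+-cong (eq x y) (row ys)) (sym (distribˡ _ _ _))

module TreeSums {c ℓ} (R : CommutativeRing c ℓ) (X Q : CommutativeRing.Carrier R) (j : ℕ) where

  open CommutativeRing R hiding (zero)
  open ListSum R
  open Exp commutativeSemiring using (_^_; ^-homo-*)
  open import Algebra.Solver.Ring.NaturalCoefficients.Default commutativeSemiring
    using (solve; _:=_; _:+_; _:*_; con)
  open SetoidReasoning setoid

  term : ℕ → Tree → Carrier
  term d t = X ^ size t * Q ^ weight j d t

  -- The contribution of `r` as a right child: besides its own term it carries the descent that its
  -- nonemptiness creates at the parent.
  factor : ℕ → Tree → Carrier
  factor d r = X ^ size r * Q ^ (unless-leaf r (d C j) ℕ.+ weight j d r)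

  term-node : ∀ d l r → term d (node l r) ≈ X * term (suc d) l * factor d r
  term-node d l r = begin
    X * X ^ (size l ℕ.+ size r) * Q ^ (weight j (suc d) l ℕ.+ v)
      ≈⟨ *-cong (*-congˡ (^-homo-* X (size l) (size r))) (^-homo-* Q (weight j (suc d) l) v) ⟩
    X * (X ^ size l * X ^ size r) * (Q ^ weight j (suc d) l * Q ^ v)
      ≈⟨ solve 5 (λ x a b c d → x :* (a :* b) :* (c :* d) := x :* (a :* c) :* (b :* d)) refl X _ _ _ _ ⟩
    X * term (suc d) l * factor d r ∎
    where
    v = unless-leaf r (d C j) ℕ.+ weight j d r

  g≤ : ℕ → ℕ → Carrier
  g≤ h d = Σ (nodes-of-height≤ h) (term d)

  Σ-factor : ∀ h d → Σ (nodes-of-height≤ h) (factor d) ≈ Q ^ (d C j) * g≤ h d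
  Σ-factor zero    d = sym (zeroʳ _)
  Σ-factor (suc h) d = begin
    Σ (cartesianProductWith node ts ts) (factor d)   ≈⟨ Σ-cartesianProductWith node ts ts factor-node ⟩
    Q ^ (d C j) * X * Σ ts (term (suc d)) * Σ ts (factor d)
      ≈⟨ solve 4 (λ a b c d → a :* b :* c :* d := a :* (b :* c :* d)) refl _ _ _ _ ⟩
    Q ^ (d C j) * (X * Σ ts (term (suc d)) * Σ ts (factor d))
      ≈⟨ *-congˡ (Σ-cartesianProductWith node ts ts (term-node d)) ⟨
    Q ^ (d C j) * g≤ (suc h) d ∎
    where
    ts = trees-of-height≤ h
    factor-node : ∀ l r → factor d (node l r) ≈ Q ^ (d C j) * X * term (suc d) l * factor d r
    factor-node l r = begin
      X ^ size (node l r) * Q ^ (d C j ℕ.+ weight j d (node l r))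
        ≈⟨ *-congˡ (^-homo-* Q (d C j) _) ⟩
      X ^ size (node l r) * (Q ^ (d C j) * Q ^ weight j d (node l r))
        ≈⟨ solve 3 (λ a b c → a :* (b :* c) := b :* (a :* c)) refl _ _ _ ⟩
      Q ^ (d C j) * term d (node l r)
        ≈⟨ *-congˡ (term-node d l r) ⟩
      Q ^ (d C j) * (X * term (suc d) l * factor d r)
        ≈⟨ solve 4 (λ a b c d → a :* (b :* c :* d) := a :* b :* c :* d) refl _ _ _ _ ⟩
      Q ^ (d C j) * X * term (suc d) l * factor d r ∎

  step : ℕ → Carrier → Carrier → Carrier
  step d a b = (1# + a) * (1# + Q ^ (d C j) * b)

  g≤-suc : ∀ h d → g≤ (suc h) d ≈ X * step d (g≤ h (suc d)) (g≤ h d)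
  g≤-suc h d = begin
    g≤ (suc h) d                                       ≈⟨ Σ-cartesianProductWith node ts ts (term-node d) ⟩
    X * (1# * 1# + g≤ h (suc d)) * (1# * 1# + Σ (nodes-of-height≤ h) (factor d))
      ≈⟨ *-congˡ (+-congˡ (Σ-factor h d)) ⟩
    X * (1# * 1# + g≤ h (suc d)) * (1# * 1# + Q ^ (d C j) * g≤ h d)
      ≈⟨ solve 4 (λ x a q b → x :* (con 1 :* con 1 :+ a) :* (con 1 :* con 1 :+ q :* b) := x :* ((con 1 :+ a) :* (con 1 :+ q :* b)))
           refl X (g≤ h (suc d)) (Q ^ (d C j)) (g≤ h d) ⟩
    X * step d (g≤ h (suc d)) (g≤ h d)                 ∎
    where
    ts = trees-of-height≤ h

-- The generating function in x and truncated q, and its coefficients in q.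

module GeneratingFunctions {c ℓ} (K : CommutativeRing c ℓ) (j : ℕ) where

  private
    module K = CommutativeRing K
    -- Series in q are taken modulo q^(j+1).
    module K[q] = PowerSeries K (ℕ._≤ j) ℕ.≤-trans
    K⟦q⟧ = K[q].power-series
    module K⟦q⟧ = CommutativeRing K⟦q⟧
    module K[x] = PowerSeries K (λ _ → ⊤) (λ _ _ → tt)
    K⟦x⟧ = K[x].power-series
    module K⟦x⟧ = CommutativeRing K⟦x⟧
    module K[q][x] = PowerSeries K⟦q⟧ (λ _ → ⊤) (λ _ _ → tt)
    S = K[q][x].power-series

  open CommutativeRing S hiding (zero)
  open K[q][x] using (X)
  open Exp commutativeSemiring using (_^_)

  Q : Carrier
  Q = K[q][x].const K[q].X

  open TreeSums S X Q j

  step-cong-≤ : ∀ d n {a a′ b b′} → (∀ i → i ℕ.≤ n → a i K⟦q⟧.≈ a′ i) → (∀ i → i ℕ.≤ n → b i K⟦q⟧.≈ b′ i) →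
                step d a b n K⟦q⟧.≈ step d a′ b′ n
  step-cong-≤ d n p q = K[q][x].⊛-cong-≤ n (λ i i≤n → K⟦q⟧.+-congˡ (p i i≤n))
    (λ i i≤n → K⟦q⟧.+-congˡ (K[q][x].⊛-cong-≤ i (λ _ _ → K⟦q⟧.refl) (λ i′ i′≤i → q i′ (ℕ.≤-trans i′≤i i≤n))))

  g≤-coefficient-zero : ∀ h d → g≤ h d 0 K⟦q⟧.≈ K⟦q⟧.0#
  g≤-coefficient-zero zero    d = K⟦q⟧.refl
  g≤-coefficient-zero (suc h) d = K⟦q⟧.trans (g≤-suc h d 0 tt) (K[q][x].X-⊛ (step d (g≤ h (suc d)) (g≤ h d)) 0)

  g≤-coefficient-suc : ∀ h d n → g≤ (suc h) d (suc n) K⟦q⟧.≈ step d (g≤ h (suc d)) (g≤ h d) n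
  g≤-coefficient-suc h d n = K⟦q⟧.trans (g≤-suc h d (suc n) tt) (K[q][x].X-⊛ _ (suc n))

  -- Each level of height brings a factor `X`, so coefficient n + 1 at height h + 1 depends only on
  -- coefficients up to n at height h. The diagonal `g` below is therefore the coefficientwise
  -- limit.
  g≤-stable : ∀ {h h′} d n → n ℕ.≤ h → n ℕ.≤ h′ → g≤ h d n K⟦q⟧.≈ g≤ h′ d n
  g≤-stable {h} {h′} d zero _ _ = K⟦q⟧.trans (g≤-coefficient-zero h d) (K⟦q⟧.sym (g≤-coefficient-zero h′ d))
  g≤-stable {suc h} {suc h′} d (suc n) (s≤s n≤h) (s≤s n≤h′) =
    K⟦q⟧.trans (g≤-coefficient-suc h d n) (K⟦q⟧.trans
      (step-cong-≤ d n (λ i i≤n → g≤-stable (suc d) i (ℕ.≤-trans i≤n n≤h) (ℕ.≤-trans i≤n n≤h′))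
                       (λ i i≤n → g≤-stable d i (ℕ.≤-trans i≤n n≤h) (ℕ.≤-trans i≤n n≤h′)))
      (K⟦q⟧.sym (g≤-coefficient-suc h′ d n)))

  g : ℕ → Carrier
  g d n = g≤ n d n

  g-coefficient-suc : ∀ d n → g d (suc n) K⟦q⟧.≈ step d (g (suc d)) (g d) n
  g-coefficient-suc d n = K⟦q⟧.trans (g≤-coefficient-suc n d n)
    (step-cong-≤ d n (λ i i≤n → g≤-stable (suc d) i i≤n ℕ.≤-refl) (λ i i≤n → g≤-stable d i i≤n ℕ.≤-refl))

  g-equation : ∀ d → g d ≈ X * step d (g (suc d)) (g d)
  g-equation d zero    _ = K⟦q⟧.sym (K[q][x].X-⊛ (step d (g (suc d)) (g d)) 0)
  g-equation d (suc n) _ = K⟦q⟧.trans (g-coefficient-suc d n) (K⟦q⟧.sym (K[q][x].X-⊛ _ (suc n)))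

  coefficient : ℕ → Carrier → K⟦x⟧.Carrier
  coefficient r a n = a n r

  coefficient-X : ∀ r a → r ℕ.≤ j → coefficient r (X * a) K⟦x⟧.≈ K[x].X K⟦x⟧.* coefficient r a
  coefficient-X r a r≤j zero    _ = K.trans (K[q][x].X-⊛ a 0 r r≤j) (K.sym (K[x].X-⊛ (coefficient r a) 0))
  coefficient-X r a r≤j (suc n) _ = K.trans (K[q][x].X-⊛ a (suc n) r r≤j) (K.sym (K[x].X-⊛ _ (suc n)))

  coefficient-Q : ∀ r a n → r ℕ.≤ j → (Q * a) n r K.≈ K[q].shift1 (a n) r
  coefficient-Q r a n r≤j = K.trans (K[q][x].const-⊛ K[q].X a n r r≤j) (K[q].X-⊛ (a n) r)

  -- Powers of q above j have their only nonzero coefficient outside the range that the truncated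
  -- equality inspects.
  Q-nilpotent : ∀ w → suc j ℕ.≤ w → Q ^ w ≈ 0#
  Q-nilpotent w j<w n _ r r≤j = vanishes w r (ℕ.≤-trans (s≤s r≤j) j<w) r≤j
    where
    vanishes : ∀ w r → r ℕ.< w → r ℕ.≤ j → (Q ^ w) n r K.≈ K.0#
    vanishes (suc w) zero    _         r≤j = coefficient-Q zero (Q ^ w) n r≤j
    vanishes (suc w) (suc r) (s≤s r<w) r≤j =
      K.trans (coefficient-Q (suc r) (Q ^ w) n r≤j) (vanishes w r r<w (ℕ.≤-trans (ℕ.n≤1+n r) r≤j))

  [_] : ∀ {P : Set} → Dec P → K.Carrier
  [ P? ] = if does P? then K.1# else K.0#

  coefficient-monomial : ∀ m w n r → r ℕ.≤ j →
    (X ^ m * Q ^ w) n r K.≈ [ (m ℕ.≟ n) ×-dec (w ℕ.≟ r) ]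
  coefficient-monomial zero w n r r≤j = K.trans (*-identityˡ (Q ^ w) n tt r r≤j) (power n w r r≤j)
    where
    power : ∀ n w r → r ℕ.≤ j → (Q ^ w) n r K.≈ [ (0 ℕ.≟ n) ×-dec (w ℕ.≟ r) ]
    power zero    zero    zero    _   = K.refl
    power zero    zero    (suc r) _   = K.refl
    power (suc n) zero    r       _   = K.refl
    power zero    (suc w) zero    r≤j = coefficient-Q zero (Q ^ w) zero r≤j
    power (suc n) (suc w) zero    r≤j = coefficient-Q zero (Q ^ w) (suc n) r≤j
    power zero    (suc w) (suc r) r≤j = K.trans (coefficient-Q (suc r) (Q ^ w) zero r≤j)
      (power zero w r (ℕ.≤-trans (ℕ.n≤1+n r) r≤j))
    power (suc n) (suc w) (suc r) r≤j = K.trans (coefficient-Q (suc r) (Q ^ w) (suc n) r≤j)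
      (power (suc n) w r (ℕ.≤-trans (ℕ.n≤1+n r) r≤j))
  coefficient-monomial (suc m) w zero r r≤j =
    K.trans (*-assoc X (X ^ m) (Q ^ w) 0 tt r r≤j) (K[q][x].X-⊛ (X ^ m * Q ^ w) 0 r r≤j)
  coefficient-monomial (suc m) w (suc n) r r≤j =
    K.trans (*-assoc X (X ^ m) (Q ^ w) (suc n) tt r r≤j)
      (K.trans (K[q][x].X-⊛ _ (suc n) r r≤j) (coefficient-monomial m w n r r≤j))

  open ReducedChebyshev S X using (Möbius; möbius-zero; möbius-suc) renaming (u to uₛ)
  open ReducedChebyshev K⟦x⟧ K[x].X using (u)

  -- `uₛ` is free of q, so taking the coefficient of q^r is linear over it. The same polynomials
  -- occur as `uₛ` over the ring with q and as `u` over the ring without.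
  coefficient-u : ∀ i r a → r ℕ.≤ j → coefficient r (uₛ i * a) K⟦x⟧.≈ u i K⟦x⟧.* coefficient r a
  coefficient-u zero          r a r≤j n _ =
    K.trans (*-identityˡ a n tt r r≤j) (K.sym (K⟦x⟧.*-identityˡ _ n tt))
  coefficient-u (suc zero)    r a r≤j = coefficient-u zero r a r≤j
  coefficient-u (suc (suc i)) r a r≤j = begin
    coefficient r ((uₛ (suc i) - X * uₛ i) * a)
      ≈⟨ (λ n _ → [y-z]x≈yx-zx a (uₛ (suc i)) (X * uₛ i) n tt r r≤j) ⟩
    coefficient r (uₛ (suc i) * a) K⟦x⟧.- coefficient r (X * uₛ i * a)
      ≈⟨ K⟦x⟧.+-cong (coefficient-u (suc i) r a r≤j) (K⟦x⟧.-‿cong shifted) ⟩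
    u (suc i) K⟦x⟧.* coefficient r a K⟦x⟧.- K[x].X K⟦x⟧.* u i K⟦x⟧.* coefficient r a
      ≈⟨ [y-z]x≈yx-zx₁ (coefficient r a) (u (suc i)) (K[x].X K⟦x⟧.* u i) ⟨
    u (suc (suc i)) K⟦x⟧.* coefficient r a ∎
    where
    open SetoidReasoning K⟦x⟧.setoid
    open RingProperties ring using ([y-z]x≈yx-zx)
    open RingProperties K⟦x⟧.ring using () renaming ([y-z]x≈yx-zx to [y-z]x≈yx-zx₁)
    shifted : coefficient r (X * uₛ i * a) K⟦x⟧.≈ K[x].X K⟦x⟧.* u i K⟦x⟧.* coefficient r a
    shifted = begin
      coefficient r (X * uₛ i * a)                       ≈⟨ (λ n _ → *-assoc X (uₛ i) a n tt r r≤j) ⟩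
      coefficient r (X * (uₛ i * a))                     ≈⟨ coefficient-X r (uₛ i * a) r≤j ⟩
      K[x].X K⟦x⟧.* coefficient r (uₛ i * a)             ≈⟨ K⟦x⟧.*-congˡ (coefficient-u i r a r≤j) ⟩
      K[x].X K⟦x⟧.* (u i K⟦x⟧.* coefficient r a)         ≈⟨ K⟦x⟧.*-assoc _ _ _ ⟨
      K[x].X K⟦x⟧.* u i K⟦x⟧.* coefficient r a           ∎

  trees : ℕ → Carrier
  trees d = 1# + g d

  geometric : Carrier
  geometric _ = K⟦q⟧.1#

  geometric-equation : geometric ≈ 1# + X * geometric
  geometric-equation zero    _ = K⟦q⟧.sym (K⟦q⟧.trans (K⟦q⟧.+-congˡ (K[q][x].X-⊛ geometric 0)) (K⟦q⟧.+-identityʳ _))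
  geometric-equation (suc n) _ = K⟦q⟧.sym (K⟦q⟧.trans (K⟦q⟧.+-congˡ (K[q][x].X-⊛ geometric (suc n))) (K⟦q⟧.+-identityˡ _))

  -- Below left depth j a right child costs a vanishing power of q. Only chains of left children
  -- remain, one of each size, whence the series 1/(1 - x). The induction is on the coefficient
  -- while the depth grows.
  trees-deep : ∀ e → trees (suc (j ℕ.+ e)) ≈ geometric
  trees-deep e zero    _ = K⟦q⟧.+-identityʳ _
  trees-deep e (suc n) _ = K⟦q⟧.trans (K⟦q⟧.+-identityˡ _) (K⟦q⟧.trans (g-coefficient-suc d n) (K⟦q⟧.trans
    (step-trivial n tt) deeper))
    where
    d = suc (j ℕ.+ e)
    deeper : trees (suc d) n K⟦q⟧.≈ K⟦q⟧.1#
    deeper = ≡.subst (λ i → trees (suc i) n K⟦q⟧.≈ K⟦q⟧.1#) (ℕ.+-suc j e) (trees-deep (suc e) n tt)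
    step-trivial : step d (g (suc d)) (g d) ≈ trees (suc d)
    step-trivial = begin
      trees (suc d) * (1# + Q ^ (d C j) * g d)   ≈⟨ *-congˡ {trees (suc d)} (+-congˡ {1#} (*-congʳ {g d} (Q-nilpotent (d C j) (k<nCk e j)))) ⟩
      trees (suc d) * (1# + 0# * g d)            ≈⟨ *-congˡ {trees (suc d)} (+-congˡ {1#} (zeroˡ (g d))) ⟩
      trees (suc d) * (1# + 0#)                  ≈⟨ *-congˡ {trees (suc d)} (+-identityʳ 1#) ⟩
      trees (suc d) * 1#                         ≈⟨ *-identityʳ (trees (suc d)) ⟩
      trees (suc d)                              ∎
      where open SetoidReasoning setoid

  -- `e` counts the levels above depth j. At d = j the binomial is 1 and q enters once; at d < j it
  -- is 0, so the tree equation becomes one step P_d = 1 + x P_(d+1) P_d of the continued fraction.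
  trees-möbius : ∀ d e → d ℕ.+ e ≡ j → Möbius Q e (trees d)
  trees-möbius d zero    d+0≡j = möbius-zero {Q} {geometric} {g d} geometric-equation (begin
    g d                                                      ≈⟨ g-equation d ⟩
    X * (trees (suc d) * (1# + Q ^ (d C j) * g d))           ≈⟨ *-assoc X _ _ ⟨
    X * trees (suc d) * (1# + Q ^ (d C j) * g d)
      ≈⟨ *-cong {X * trees (suc d)} {X * geometric} {1# + Q ^ (d C j) * g d} {1# + Q * g d}
           (*-congˡ {X} deep) (+-congˡ {1#} (*-congʳ {g d} Q^1)) ⟩
    X * geometric * (1# + Q * g d)                           ∎)
    where
    open SetoidReasoning setoid
    d≡j = ≡.trans (≡.sym (ℕ.+-identityʳ d)) d+0≡j
    deep : trees (suc d) ≈ geometric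
    deep = ≡.subst (λ i → trees (suc i) ≈ geometric) (≡.trans (ℕ.+-identityʳ j) (≡.sym d≡j)) (trees-deep 0)
    Q^1 : Q ^ (d C j) ≈ Q
    Q^1 = ≡.subst (λ w → Q ^ w ≈ Q) (≡.sym (≡.trans (≡.cong (_C j) d≡j) (nCn≡1 j))) (*-identityʳ Q)
  trees-möbius d (suc e) d+e≡j =
    möbius-suc {Q} e {trees (suc d)} {trees d} (trees-möbius (suc d) e (≡.trans (≡.sym (ℕ.+-suc d e)) d+e≡j)) (begin
      1# + g d                                                    ≈⟨ +-congˡ {1#} (g-equation d) ⟩
      1# + X * (trees (suc d) * (1# + Q ^ (d C j) * g d))
        ≈⟨ +-congˡ {1#} (*-congˡ {X} (*-congˡ {trees (suc d)} (+-congˡ {1#} (trans (*-congʳ {g d} Q^0) (*-identityˡ (g d)))))) ⟩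
      1# + X * (trees (suc d) * trees d)                          ≈⟨ +-congˡ {1#} (*-assoc X (trees (suc d)) (trees d)) ⟨
      1# + X * trees (suc d) * trees d                            ∎)
    where
    open SetoidReasoning setoid
    d<j : d ℕ.< j
    d<j = ≡.subst (d ℕ.<_) d+e≡j (ℕ.m<m+n d (s≤s z≤n))
    Q^0 : Q ^ (d C j) ≈ 1#
    Q^0 = ≡.subst (λ w → Q ^ w ≈ 1#) (≡.sym (k>n⇒nCk≡0 d<j)) (refl {1#})

  coefficient-XuQ-zero : ∀ i a → coefficient 0 (X * uₛ i * Q * a) K⟦x⟧.≈ K⟦x⟧.0#
  coefficient-XuQ-zero i a n _ = K.trans (rearrange (X * uₛ i) n tt 0 z≤n) (coefficient-Q 0 (X * uₛ i * a) n z≤n)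
    where
    rearrange : ∀ b → b * Q * a ≈ Q * (b * a)
    rearrange b = trans (*-congʳ {a} (*-comm b Q)) (*-assoc Q b a)

  coefficient-XuQ-suc : ∀ i r a → suc r ℕ.≤ j →
    coefficient (suc r) (X * uₛ i * Q * a) K⟦x⟧.≈ K[x].X K⟦x⟧.* u i K⟦x⟧.* coefficient r a
  coefficient-XuQ-suc i r a r<j = begin
    coefficient (suc r) (X * uₛ i * Q * a)
      ≈⟨ (λ n _ → K.trans (rearrange (X * uₛ i) n tt (suc r) r<j) (coefficient-Q (suc r) (X * uₛ i * a) n r<j)) ⟩
    coefficient r (X * uₛ i * a)                       ≈⟨ (λ n _ → *-assoc X (uₛ i) a n tt r r≤j) ⟩
    coefficient r (X * (uₛ i * a))                     ≈⟨ coefficient-X r (uₛ i * a) r≤j ⟩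
    K[x].X K⟦x⟧.* coefficient r (uₛ i * a)             ≈⟨ K⟦x⟧.*-congˡ (coefficient-u i r a r≤j) ⟩
    K[x].X K⟦x⟧.* (u i K⟦x⟧.* coefficient r a)         ≈⟨ K⟦x⟧.*-assoc _ _ _ ⟨
    K[x].X K⟦x⟧.* u i K⟦x⟧.* coefficient r a           ∎
    where
    open SetoidReasoning K⟦x⟧.setoid
    r≤j = ℕ.≤-trans (ℕ.n≤1+n r) r<j
    rearrange : ∀ b → b * Q * a ≈ Q * (b * a)
    rearrange b = trans (*-congʳ {a} (*-comm b Q)) (*-assoc Q b a)

  coefficient-1-zero : coefficient 0 1# K⟦x⟧.≈ K⟦x⟧.1#
  coefficient-1-zero zero    _ = K.refl
  coefficient-1-zero (suc _) _ = K.refl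

  coefficient-1-suc : ∀ r → coefficient (suc r) 1# K⟦x⟧.≈ K⟦x⟧.0#
  coefficient-1-suc r zero    _ = K.refl
  coefficient-1-suc r (suc _) _ = K.refl

  distribution : ℕ → K⟦x⟧.Carrier
  distribution r = coefficient r (trees 0)

  private
    p = distribution

  -- The factors `1#` bring all four terms to the two shapes whose coefficients are computed by
  -- `coefficient-u` and the `coefficient-XuQ` lemmas.
  coefficient-equation : ∀ r → r ℕ.≤ j →
    coefficient r (uₛ (suc (suc j)) * trees 0) K⟦x⟧.+ coefficient r (X * uₛ j * Q * 1#) K⟦x⟧.≈
    coefficient r (uₛ (suc j) * 1#) K⟦x⟧.+ coefficient r (X * uₛ (suc j) * Q * trees 0)
  coefficient-equation r r≤j n _ = equation n tt r r≤j
    where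
    equation : uₛ (suc (suc j)) * trees 0 + X * uₛ j * Q * 1# ≈ uₛ (suc j) * 1# + X * uₛ (suc j) * Q * trees 0
    equation = begin
      uₛ (suc (suc j)) * trees 0 + X * uₛ j * Q * 1#
        ≈⟨ +-congˡ {uₛ (suc (suc j)) * trees 0} (*-identityʳ (X * uₛ j * Q)) ⟩
      uₛ (suc (suc j)) * trees 0 + X * uₛ j * Q
        ≈⟨ trees-möbius 0 j ≡.refl ⟩
      uₛ (suc j) + X * uₛ (suc j) * Q * trees 0
        ≈⟨ +-congʳ {X * uₛ (suc j) * Q * trees 0} (*-identityʳ (uₛ (suc j))) ⟨
      uₛ (suc j) * 1# + X * uₛ (suc j) * Q * trees 0 ∎
      where open SetoidReasoning setoid

  open SetoidReasoning K⟦x⟧.setoid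

  distribution-zero : u (suc (suc j)) K⟦x⟧.* p 0 K⟦x⟧.≈ u (suc j)
  distribution-zero = begin
    u (suc (suc j)) K⟦x⟧.* p 0                  ≈⟨ coefficient-u (suc (suc j)) 0 (trees 0) z≤n ⟨
    coefficient 0 (uₛ (suc (suc j)) * trees 0)  ≈⟨ K⟦x⟧.+-identityʳ _ ⟨
    coefficient 0 (uₛ (suc (suc j)) * trees 0) K⟦x⟧.+ K⟦x⟧.0#
      ≈⟨ K⟦x⟧.+-congˡ (coefficient-XuQ-zero j 1#) ⟨
    coefficient 0 (uₛ (suc (suc j)) * trees 0) K⟦x⟧.+ coefficient 0 (X * uₛ j * Q * 1#)
      ≈⟨ coefficient-equation 0 z≤n ⟩
    coefficient 0 (uₛ (suc j) * 1#) K⟦x⟧.+ coefficient 0 (X * uₛ (suc j) * Q * trees 0)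
      ≈⟨ K⟦x⟧.+-cong (coefficient-u (suc j) 0 1# z≤n) (coefficient-XuQ-zero (suc j) (trees 0)) ⟩
    u (suc j) K⟦x⟧.* coefficient 0 1# K⟦x⟧.+ K⟦x⟧.0#     ≈⟨ K⟦x⟧.+-identityʳ _ ⟩
    u (suc j) K⟦x⟧.* coefficient 0 1#                    ≈⟨ K⟦x⟧.*-congˡ coefficient-1-zero ⟩
    u (suc j) K⟦x⟧.* K⟦x⟧.1#                             ≈⟨ K⟦x⟧.*-identityʳ _ ⟩
    u (suc j)                                            ∎

  -- The second summand survives only at `r` = 0. This is why the step from `p 0` to `p 1` is
  -- exceptional and the later ones are geometric.
  distribution-suc : ∀ r → suc r ℕ.≤ j →
    u (suc (suc j)) K⟦x⟧.* p (suc r) K⟦x⟧.+ K[x].X K⟦x⟧.* u j K⟦x⟧.* coefficient r 1# K⟦x⟧.≈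
    K[x].X K⟦x⟧.* u (suc j) K⟦x⟧.* p r
  distribution-suc r r<j = begin
    u (suc (suc j)) K⟦x⟧.* p (suc r) K⟦x⟧.+ K[x].X K⟦x⟧.* u j K⟦x⟧.* coefficient r 1#
      ≈⟨ K⟦x⟧.+-cong (coefficient-u (suc (suc j)) (suc r) (trees 0) r<j) (coefficient-XuQ-suc j r 1# r<j) ⟨
    coefficient (suc r) (uₛ (suc (suc j)) * trees 0) K⟦x⟧.+ coefficient (suc r) (X * uₛ j * Q * 1#)
      ≈⟨ coefficient-equation (suc r) r<j ⟩
    coefficient (suc r) (uₛ (suc j) * 1#) K⟦x⟧.+ coefficient (suc r) (X * uₛ (suc j) * Q * trees 0)
      ≈⟨ K⟦x⟧.+-cong (coefficient-u (suc j) (suc r) 1# r<j) (coefficient-XuQ-suc (suc j) r (trees 0) r<j) ⟩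
    u (suc j) K⟦x⟧.* coefficient (suc r) 1# K⟦x⟧.+ K[x].X K⟦x⟧.* u (suc j) K⟦x⟧.* p r
      ≈⟨ K⟦x⟧.+-congʳ (K⟦x⟧.*-congˡ (coefficient-1-suc r)) ⟩
    u (suc j) K⟦x⟧.* K⟦x⟧.0# K⟦x⟧.+ K[x].X K⟦x⟧.* u (suc j) K⟦x⟧.* p r
      ≈⟨ K⟦x⟧.+-congʳ (K⟦x⟧.zeroʳ _) ⟩
    K⟦x⟧.0# K⟦x⟧.+ K[x].X K⟦x⟧.* u (suc j) K⟦x⟧.* p r   ≈⟨ K⟦x⟧.+-identityˡ _ ⟩
    K[x].X K⟦x⟧.* u (suc j) K⟦x⟧.* p r                   ∎

  open Exp K⟦x⟧.commutativeSemiring using () renaming (_^_ to _^ₓ_)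
  open ReducedChebyshev K⟦x⟧ K[x].X using (möbius-coefficient)

  distribution-closed-form : ∀ r → suc r ℕ.≤ j →
    u (suc (suc j)) ^ₓ suc (suc r) K⟦x⟧.* p (suc r) K⟦x⟧.≈
    K[x].X ^ₓ r K⟦x⟧.* u (suc j) ^ₓ r K⟦x⟧.* K[x].X ^ₓ suc (suc j)
  distribution-closed-form r r<j = möbius-coefficient j p distribution-zero first r rest
    where
    first : u (suc (suc j)) K⟦x⟧.* p 1 K⟦x⟧.+ K[x].X K⟦x⟧.* u j K⟦x⟧.≈ K[x].X K⟦x⟧.* u (suc j) K⟦x⟧.* p 0
    first = begin
      u (suc (suc j)) K⟦x⟧.* p 1 K⟦x⟧.+ K[x].X K⟦x⟧.* u j
        ≈⟨ K⟦x⟧.+-congˡ (K⟦x⟧.trans (K⟦x⟧.*-congˡ coefficient-1-zero) (K⟦x⟧.*-identityʳ _)) ⟨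
      u (suc (suc j)) K⟦x⟧.* p 1 K⟦x⟧.+ K[x].X K⟦x⟧.* u j K⟦x⟧.* coefficient 0 1#
        ≈⟨ distribution-suc 0 (ℕ.≤-trans (s≤s z≤n) r<j) ⟩
      K[x].X K⟦x⟧.* u (suc j) K⟦x⟧.* p 0 ∎
    rest : ∀ i → i ℕ.< r → u (suc (suc j)) K⟦x⟧.* p (suc (suc i)) K⟦x⟧.≈ K[x].X K⟦x⟧.* u (suc j) K⟦x⟧.* p (suc i)
    rest i i<r = begin
      u (suc (suc j)) K⟦x⟧.* p (suc (suc i))   ≈⟨ K⟦x⟧.+-identityʳ _ ⟨
      u (suc (suc j)) K⟦x⟧.* p (suc (suc i)) K⟦x⟧.+ K⟦x⟧.0#
        ≈⟨ K⟦x⟧.+-congˡ (K⟦x⟧.trans (K⟦x⟧.*-congˡ (coefficient-1-suc i)) (K⟦x⟧.zeroʳ _)) ⟨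
      u (suc (suc j)) K⟦x⟧.* p (suc (suc i)) K⟦x⟧.+ K[x].X K⟦x⟧.* u j K⟦x⟧.* coefficient (suc i) 1#
        ≈⟨ distribution-suc (suc i) (ℕ.≤-trans (s≤s i<r) r<j) ⟩
      K[x].X K⟦x⟧.* u (suc j) K⟦x⟧.* p (suc i) ∎

  has-statistics? : ∀ n r → Decidable (λ t → size t ≡ n × weight j 0 t ≡ r)
  has-statistics? n r t = (size t ℕ.≟ n) ×-dec (weight j 0 t ℕ.≟ r)

  open Mult K.+-monoid using () renaming (_×_ to _·_)

  count-∷ : ∀ {P : Tree → Set} (P? : Decidable P) t ts →
    [ P? t ] K.+ length (filter P? ts) · K.1# K.≈ length (filter P? (t ∷ ts)) · K.1#
  count-∷ P? t ts with does (P? t)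
  ... | true  = K.refl
  ... | false = K.+-identityˡ _

  Σ-term-count : ∀ ts n r → r ℕ.≤ j →
    ListSum.Σ S ts (term 0) n r K.≈ length (filter (has-statistics? n r) ts) · K.1#
  Σ-term-count []       n r r≤j = K.refl
  Σ-term-count (t ∷ ts) n r r≤j = K.trans
    (K.+-cong (coefficient-monomial (size t) (weight j 0 t) n r r≤j) (Σ-term-count ts n r r≤j))
    (count-∷ (has-statistics? n r) t ts)

  distribution-count : ∀ n r → r ℕ.≤ j →
    p r n K.≈ length (filter (has-statistics? n r) (trees-of-height≤ n)) · K.1#
  -- The height bound agrees with the diagonal index in `g`, and the leading `leaf` of the list
  -- accounts for the summand `1#` of `trees`.
  distribution-count n r r≤j = K.trans (K.+-congʳ (K.sym (*-identityˡ 1# n tt r r≤j)))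
    (Σ-term-count (trees-of-height≤ n) n r r≤j)

-- Counting by enumeration

open import Data.Fin.Base as Fin using (Fin; toℕ; zero; suc; fromℕ<)
open import Data.Fin.Permutation using (_⟨$⟩ʳ_; _⟨$⟩ˡ_; Permutation′; inverseˡ)
import Data.Fin.Properties as Fin
open import Data.List.Membership.DecPropositional ℕ._≟_ using (_∈?_)
open import Data.List.Membership.Propositional using (_∈_; _∉_)
open import Data.List.Membership.Propositional.Properties
  using (∈-map⁺; ∈-map⁻; ∈-++⁺ˡ; ∈-++⁺ʳ; ∈-++⁻; ∈-filter⁺; ∈-filter⁻; ∈-allFin; ∈-cartesianProductWith⁺;
         ∈-cartesianProductWith⁻; ∈-∃++; ∈-lookup; ∈-upTo⁻)
open import Data.List.Membership.Propositional.Properties.WithK using (unique∧set⇒bag)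
import Data.List.Properties as List
open import Data.List.Relation.Binary.BagAndSetEquality using (∼bag⇒↭)
open import Data.List.Relation.Binary.Permutation.Propositional.Properties using (↭-length)
open import Data.List.Relation.Unary.All as All using (All; []; _∷_)
import Data.List.Relation.Unary.All.Properties as All
open import Data.List.Relation.Unary.AllPairs as AllPairs using (AllPairs; []; _∷_)
import Data.List.Relation.Unary.AllPairs.Properties as AllPairs
open import Data.List.Relation.Unary.Any using (here; there)
open import Data.List.Relation.Unary.Unique.Propositional using (Unique)
import Data.List.Relation.Unary.Unique.Propositional.Properties as Unique
open import Data.Nat.Solver using (module +-*-Solver)
open import Data.Sum.Base using (_⊎_; inj₁; inj₂)
open import Data.Vec.Base as Vec using (Vec; []; _∷_; lookup; toList)
import Data.Vec.Properties as Vec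
import Data.Vec.Relation.Unary.All as VecAll
import Data.Vec.Relation.Unary.AllPairs as VecAllPairs
import Data.Vec.Relation.Unary.Unique.Propositional as Vec
open import Function.Bundles using (_⇔_; mk⇔; module Equivalence)
open import Relation.Binary.Definitions using (tri<; tri≈; tri>)
open import Relation.Binary.PropositionalEquality
  using (refl; sym; trans; cong; cong₂; subst; subst₂; module ≡-Reasoning)
open import Relation.Nullary.Negation.Core using (¬_; contradiction)
open import Defs
  using (Pattern; 1-3-2; 21-3-⋯-; IsOccurrence; isOccurrence?; words; occurrences; Counted; counted?; f)

open Equivalence using (to; from)

private variable
  l m n N : ℕ
  xs ys L R : List ℕ

infix 4 _HasCard_
-- Any duplicate-free enumeration may witness the cardinality, so counts coming from unrelated lists
-- can be compared through the predicate alone.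
_HasCard_ : {A : Set} → (A → Set) → ℕ → Set
P HasCard n = ∃[ xs ] Unique xs × (∀ x → x ∈ xs ⇔ P x) × length xs ≡ n

module _ {A : Set} {P : A → Set} where

  HasCard-unique : ∀ {m n} → P HasCard m → P HasCard n → m ≡ n
  HasCard-unique (xs , xs! , xs⇔ , refl) (ys , ys! , ys⇔ , refl) =
    ↭-length (∼bag⇒↭ (unique∧set⇒bag xs! ys!
      (mk⇔ (λ x∈xs → from (ys⇔ _) (to (xs⇔ _) x∈xs)) (λ x∈ys → from (xs⇔ _) (to (ys⇔ _) x∈ys)))))

  HasCard-filter : (P? : Decidable P) → ∀ {xs} → Unique xs → (∀ x → P x → x ∈ xs) →
                   P HasCard length (filter P? xs)
  HasCard-filter P? {xs} xs! complete = filter P? xs , Unique.filter⁺ P? xs! ,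
    (λ x → mk⇔ (λ x∈ → proj₂ (∈-filter⁻ P? {xs = xs} x∈)) (λ Px → ∈-filter⁺ P? (complete x Px) Px)) , refl

  HasCard-∅ : (∀ x → ¬ P x) → P HasCard 0
  HasCard-∅ ¬P = [] , [] , (λ x → mk⇔ (λ ()) (λ Px → contradiction Px (¬P x))) , refl

  HasCard-singleton : ∀ x → (∀ y → P y ⇔ x ≡ y) → P HasCard 1
  HasCard-singleton x P⇔ = x ∷ [] , [] ∷ [] ,
    (λ y → mk⇔ (λ { (here y≡x) → from (P⇔ y) (sym y≡x) ; (there ()) }) (λ Py → here (sym (to (P⇔ y) Py)))) , refl

  HasCard-0⇔∅ : ∀ {n} → P HasCard n → (n ≡ 0) ⇔ (∀ x → ¬ P x)
  HasCard-0⇔∅ {n} P#n = mk⇔ (empty P#n) (λ ¬P → HasCard-unique P#n (HasCard-∅ ¬P))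
    where
    empty : P HasCard n → n ≡ 0 → ∀ x → ¬ P x
    empty ([] , _ , xs⇔ , _) _ x Px with () ← from (xs⇔ x) Px
    empty (_ ∷ _ , _ , _ , refl) ()

  HasCard-⊎ : ∀ {Q R : A → Set} {m n} → Q HasCard m → R HasCard n →
              (∀ x → P x ⇔ (Q x ⊎ R x)) → (∀ x → Q x → ¬ R x) → P HasCard (m ℕ.+ n)
  HasCard-⊎ (xs , xs! , xs⇔ , refl) (ys , ys! , ys⇔ , refl) P⇔ disjoint =
    xs ++ ys ,
    Unique.++⁺ xs! ys! (λ (x∈xs , x∈ys) → disjoint _ (to (xs⇔ _) x∈xs) (to (ys⇔ _) x∈ys)) ,
    (λ x → mk⇔ (λ x∈ → from (P⇔ x) (split x (∈-++⁻ xs x∈))) (λ Px → join x (to (P⇔ x) Px))) ,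
    List.length-++ xs
    where
    split : ∀ x → x ∈ xs ⊎ x ∈ ys → _ ⊎ _
    split x (inj₁ x∈xs) = inj₁ (to (xs⇔ x) x∈xs)
    split x (inj₂ x∈ys) = inj₂ (to (ys⇔ x) x∈ys)
    join : ∀ x → _ ⊎ _ → x ∈ xs ++ ys
    join x (inj₁ Qx) = ∈-++⁺ˡ (from (xs⇔ x) Qx)
    join x (inj₂ Rx) = ∈-++⁺ʳ xs (from (ys⇔ x) Rx)

HasCard-⇔ : ∀ {A : Set} {P Q : A → Set} {n} → P HasCard n → (∀ x → P x ⇔ Q x) → Q HasCard n
HasCard-⇔ (xs , xs! , xs⇔ , eq) P⇔Q = xs , xs! ,
  (λ x → mk⇔ (λ x∈ → to (P⇔Q x) (to (xs⇔ x) x∈)) (λ Qx → from (xs⇔ x) (from (P⇔Q x) Qx))) , eq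

Image : {A B : Set} → (A → B) → (A → Set) → B → Set
Image φ P y = ∃[ x ] P x × φ x ≡ y

HasCard-Image : ∀ {A B : Set} {P : A → Set} {n} (φ : A → B) → (∀ {x y} → φ x ≡ φ y → x ≡ y) →
                P HasCard n → Image φ P HasCard n
HasCard-Image φ φ-inj (xs , xs! , xs⇔ , refl) = map φ xs , Unique.map⁺ φ-inj xs! ,
  (λ y → mk⇔ (λ y∈ → let x , x∈xs , y≡φx = ∈-map⁻ φ y∈ in x , to (xs⇔ x) x∈xs , sym y≡φx)
             (λ { (x , Px , refl) → ∈-map⁺ φ (from (xs⇔ x) Px) })) ,
  List.length-map φ xs

words-complete : ∀ {n l} (w : Vec (Fin n) l) → w ∈ words n l
words-complete []      = here refl
words-complete (i ∷ w) = ∈-cartesianProductWith⁺ _∷_ (∈-allFin i) (words-complete w)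

words-unique : ∀ n l → Unique (words n l)
words-unique n zero    = [] ∷ []
words-unique n (suc l) = Unique.cartesianProductWith⁺ _∷_ Vec.∷-injective (Unique.allFin⁺ n) (words-unique n l)

-- Occurrences in words

when : {P : Set} → Dec P → ℕ → ℕ
when (yes _) n = n
when (no  _) n = 0

when-yes : ∀ {P : Set} (P? : Dec P) {n} → P → when P? n ≡ n
when-yes (yes _) _ = refl
when-yes (no ¬P) P = contradiction P ¬P

when-no : ∀ {P : Set} (P? : Dec P) {n} → ¬ P → when P? n ≡ 0
when-no (yes P) ¬P = contradiction P ¬P
when-no (no _)  _  = refl

HasCard-when : ∀ {A : Set} {P : A → Set} {Q : Set} {n} (Q? : Dec Q) → P HasCard n →
               (λ x → Q × P x) HasCard when Q? n
HasCard-when (yes Q) P#n = HasCard-⇔ P#n (λ x → mk⇔ (Q ,_) proj₂)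
HasCard-when (no ¬Q) _   = HasCard-∅ (λ x → ¬Q ∘ proj₁)

increasing-above : ℕ → ℕ → List ℕ → ℕ
increasing-above zero    v xs       = 1
increasing-above (suc l) v []       = 0
increasing-above (suc l) v (x ∷ xs) = increasing-above (suc l) v xs ℕ.+ when (v ℕ.<? x) (increasing-above l x xs)

-- `l` is the number of letters after the descent, so `l` = 0 counts descents. The bound passed on
-- is the descent top `x`: a letter above it is also above `y`.
21-3-count : ℕ → List ℕ → ℕ
21-3-count l []           = 0
21-3-count l (x ∷ [])     = 0
21-3-count l (x ∷ y ∷ xs) = 21-3-count l (y ∷ xs) ℕ.+ when (y ℕ.<? x) (increasing-above l x xs)

map-suc-injective : {w w′ : Vec (Fin m) l} → Vec.map Fin.suc w ≡ Vec.map Fin.suc w′ → w ≡ w′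
map-suc-injective {w = []}    {[]}      _  = refl
map-suc-injective {w = i ∷ w} {i′ ∷ w′} eq with p , q ← Vec.∷-injective eq = cong₂ _∷_ (Fin.suc-injective p) (map-suc-injective q)

nonzero⇒map-suc : (w : Vec (Fin (suc m)) l) → (∀ a → lookup w a ≢ zero) → ∃[ w′ ] Vec.map Fin.suc w′ ≡ w
nonzero⇒map-suc []          _  = [] , refl
nonzero⇒map-suc (zero  ∷ w) ≢0 = contradiction refl (≢0 zero)
nonzero⇒map-suc (suc i ∷ w) ≢0 with w′ , eq ← nonzero⇒map-suc w (≢0 ∘ suc) = i ∷ w′ , cong (suc i ∷_) eq

<⇒nonzero : {i j : Fin (suc m)} → i Fin.< j → j ≢ zero
<⇒nonzero () refl

Increasing : Vec ℕ m → Vec (Fin m) l → Set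
Increasing ys w = ∀ a b → a Fin.< b → lookup w a Fin.< lookup w b × lookup ys (lookup w a) ℕ.< lookup ys (lookup w b)

IncreasingAbove : ℕ → Vec ℕ m → Vec (Fin m) l → Set
IncreasingAbove v ys w = (∀ a → v ℕ.< lookup ys (lookup w a)) × Increasing ys w

module _ (y : ℕ) (ys : Vec ℕ m) where

  increasing-map-suc : (w : Vec (Fin m) l) → Increasing (y ∷ ys) (Vec.map Fin.suc w) ⇔ Increasing ys w
  increasing-map-suc w = mk⇔ unshift shift
    where
    Ascending : Fin (suc m) → Fin (suc m) → Set
    Ascending i j = i Fin.< j × lookup (y ∷ ys) i ℕ.< lookup (y ∷ ys) j
    unshift : Increasing (y ∷ ys) (Vec.map Fin.suc w) → Increasing ys w
    unshift inc a b a<b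
      with p , q ← subst₂ Ascending (Vec.lookup-map a Fin.suc w) (Vec.lookup-map b Fin.suc w) (inc a b a<b) = ℕ.≤-pred p , q
    shift : Increasing ys w → Increasing (y ∷ ys) (Vec.map Fin.suc w)
    shift inc a b a<b rewrite Vec.lookup-map a Fin.suc w | Vec.lookup-map b Fin.suc w =
      s≤s (proj₁ (inc a b a<b)) , proj₂ (inc a b a<b)

  above-map-suc : ∀ {v} (w : Vec (Fin m) l) →
    (∀ a → v ℕ.< lookup (y ∷ ys) (lookup (Vec.map Fin.suc w) a)) ⇔ (∀ a → v ℕ.< lookup ys (lookup w a))
  above-map-suc {v = v} w = mk⇔
    (λ p a → subst (λ i → v ℕ.< lookup (y ∷ ys) i) (Vec.lookup-map a Fin.suc w) (p a))
    (λ p a → subst (λ i → v ℕ.< lookup (y ∷ ys) i) (sym (Vec.lookup-map a Fin.suc w)) (p a))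

  increasingAbove-map-suc : ∀ {v} (w : Vec (Fin m) l) →
    IncreasingAbove v (y ∷ ys) (Vec.map Fin.suc w) ⇔ IncreasingAbove v ys w
  increasingAbove-map-suc w = mk⇔
    (λ (p , q) → to (above-map-suc w) p , to (increasing-map-suc w) q)
    (λ (p , q) → from (above-map-suc w) p , from (increasing-map-suc w) q)

  increasingAbove-zero∷ : ∀ {v} (w : Vec (Fin m) l) →
    IncreasingAbove v (y ∷ ys) (zero ∷ Vec.map Fin.suc w) ⇔ (v ℕ.< y × IncreasingAbove y ys w)
  increasingAbove-zero∷ {v = v} w = mk⇔ unshift shift
    where
    unshift : IncreasingAbove v (y ∷ ys) (zero ∷ Vec.map Fin.suc w) → v ℕ.< y × IncreasingAbove y ys w
    unshift (p , q) = p zero , to (above-map-suc w) (λ a → proj₂ (q zero (suc a) (s≤s z≤n)))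
                             , to (increasing-map-suc w) (λ a b a<b → q (suc a) (suc b) (s≤s a<b))
    shift : v ℕ.< y × IncreasingAbove y ys w → IncreasingAbove v (y ∷ ys) (zero ∷ Vec.map Fin.suc w)
    shift (v<y , p , q) = above , increasing
      where
      p′ = from (above-map-suc w) p
      above : ∀ a → v ℕ.< lookup (y ∷ ys) (lookup (zero ∷ Vec.map Fin.suc w) a)
      above zero    = v<y
      above (suc a) = ℕ.<-trans v<y (p′ a)
      increasing : Increasing (y ∷ ys) (zero ∷ Vec.map Fin.suc w)
      increasing zero    (suc b) _         = subst (Fin.zero {m} Fin.<_) (sym (Vec.lookup-map b Fin.suc w)) (s≤s z≤n) , p′ b
      increasing (suc a) (suc b) (s≤s a<b) = from (increasing-map-suc w) q a b a<b

  -- Positions increase, so position zero can only be the first entry. The two images are the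
  -- selections that skip `y` and those that begin with it, matching the two summands of
  -- `increasing-above`.
  increasingAbove-split : ∀ {v} (w : Vec (Fin (suc m)) (suc l)) → IncreasingAbove v (y ∷ ys) w ⇔
    (Image (Vec.map Fin.suc) (IncreasingAbove v ys) w ⊎
     Image (λ w′ → zero ∷ Vec.map Fin.suc w′) (λ w′ → v ℕ.< y × IncreasingAbove y ys w′) w)
  increasingAbove-split {l = l} {v} w = mk⇔ (split w) join
    where
    Split : Vec (Fin (suc m)) (suc l) → Set
    Split w = Image (Vec.map Fin.suc) (IncreasingAbove v ys) w ⊎
              Image (λ w′ → zero ∷ Vec.map Fin.suc w′) (λ w′ → v ℕ.< y × IncreasingAbove y ys w′) w
    split : ∀ w → IncreasingAbove v (y ∷ ys) w → Split w
    split (zero ∷ w) inc@(_ , q)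
      with w′ , refl ← nonzero⇒map-suc w (λ a → <⇒nonzero {j = lookup w a} (proj₁ (q zero (suc a) (s≤s z≤n))))
      = inj₂ (w′ , to (increasingAbove-zero∷ w′) inc , refl)
    split (suc i ∷ w) inc@(_ , q)
      with w′ , refl ← nonzero⇒map-suc w (λ a → <⇒nonzero {j = lookup w a} (proj₁ (q zero (suc a) (s≤s z≤n))))
      = inj₁ (i ∷ w′ , to (increasingAbove-map-suc (i ∷ w′)) inc , refl)
    join : Split w → IncreasingAbove v (y ∷ ys) w
    join (inj₁ (w′ , inc , refl)) = from (increasingAbove-map-suc w′) inc
    join (inj₂ (w′ , inc , refl)) = from (increasingAbove-zero∷ w′) inc

increasingAbove-count : ∀ l v (ys : Vec ℕ m) →
  IncreasingAbove {l = l} v ys HasCard increasing-above l v (toList ys)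
increasingAbove-count zero    v ys = HasCard-singleton [] λ where
  [] → mk⇔ (λ _ → refl) (λ _ → (λ ()) , (λ ()))
increasingAbove-count (suc l) v [] = HasCard-∅ λ { (() ∷ _) }
increasingAbove-count (suc l) v (y ∷ ys) = HasCard-⊎
  (HasCard-Image (Vec.map Fin.suc) map-suc-injective (increasingAbove-count (suc l) v ys))
  (HasCard-Image (λ w → zero ∷ Vec.map Fin.suc w) (map-suc-injective ∘ Vec.∷-injectiveʳ)
    (HasCard-when (v ℕ.<? y) (increasingAbove-count l y ys)))
  (increasingAbove-split y ys)
  λ { _ (_ ∷ _ , _ , refl) (_ , _ , ()) }

-- The comparisons of later letters with the descent bottom, and of their positions with `i`, are
-- left out; they follow by transitivity.
Is21-3 : Vec ℕ m → Vec (Fin m) (suc (suc l)) → Set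
Is21-3 ys (i ∷ j ∷ w) =
  toℕ j ≡ suc (toℕ i) × lookup ys j ℕ.< lookup ys i × (∀ a → j Fin.< lookup w a) ×
  IncreasingAbove (lookup ys i) ys w

is21-3-map-suc : ∀ y (ys : Vec ℕ m) (w : Vec (Fin m) (suc (suc l))) →
  Is21-3 (y ∷ ys) (Vec.map Fin.suc w) ⇔ Is21-3 ys w
is21-3-map-suc y ys (i ∷ j ∷ w) = mk⇔
  (λ (p , q , r , s) → ℕ.suc-injective p , q ,
     (λ a → ℕ.≤-pred (subst (suc j Fin.<_) (Vec.lookup-map a Fin.suc w) (r a))) , to (increasingAbove-map-suc y ys w) s)
  (λ (p , q , r , s) → cong suc p , q ,
     (λ a → subst (suc j Fin.<_) (sym (Vec.lookup-map a Fin.suc w)) (s≤s (r a))) , from (increasingAbove-map-suc y ys w) s)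

is21-3-split : ∀ y y′ (ys : Vec ℕ m) (w : Vec (Fin (suc (suc m))) (suc (suc l))) → Is21-3 (y ∷ y′ ∷ ys) w ⇔
  (Image (Vec.map Fin.suc) (Is21-3 (y′ ∷ ys)) w ⊎
   Image (λ w′ → zero ∷ suc zero ∷ Vec.map Fin.suc (Vec.map Fin.suc w′)) (λ w′ → y′ ℕ.< y × IncreasingAbove y ys w′) w)
is21-3-split {m} {l} y y′ ys w = mk⇔ (split w) join
  where
  Split : Vec (Fin (suc (suc m))) (suc (suc l)) → Set
  Split w =
    Image (Vec.map Fin.suc) (Is21-3 (y′ ∷ ys)) w ⊎
    Image (λ w′ → zero ∷ suc zero ∷ Vec.map Fin.suc (Vec.map Fin.suc w′)) (λ w′ → y′ ℕ.< y × IncreasingAbove y ys w′) w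
  split : ∀ w → Is21-3 (y ∷ y′ ∷ ys) w → Split w
  split (zero ∷ suc zero ∷ w) (_ , y′<y , r , s)
    with w₁ , refl ← nonzero⇒map-suc w (λ a → <⇒nonzero {j = lookup w a} (r a))
    with w₂ , refl ← nonzero⇒map-suc w₁ (λ a eq → case subst (λ i → 1 ℕ.< toℕ i)
      (trans (Vec.lookup-map a Fin.suc w₁) (cong suc eq)) (r a) of λ { (s≤s ()) })
    = inj₂ (w₂ , (y′<y , to (increasingAbove-map-suc y′ ys w₂) (to (increasingAbove-map-suc y (y′ ∷ ys) (Vec.map Fin.suc w₂)) s)) , refl)
  split (suc i ∷ suc j ∷ w) occ@(p , _ , r , _)
    with w′ , refl ← nonzero⇒map-suc w (λ a → <⇒nonzero {j = lookup w a} (r a))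
    = inj₁ (i ∷ j ∷ w′ , to (is21-3-map-suc y (y′ ∷ ys) (i ∷ j ∷ w′)) occ , refl)
  join : Split w → Is21-3 (y ∷ y′ ∷ ys) w
  join (inj₁ (w′@(_ ∷ _ ∷ _) , occ , refl)) = from (is21-3-map-suc y (y′ ∷ ys) w′) occ
  join (inj₂ (w′ , (y′<y , s) , refl)) = refl , y′<y , later , 
    from (increasingAbove-map-suc y (y′ ∷ ys) (Vec.map Fin.suc w′)) (from (increasingAbove-map-suc y′ ys w′) s)
    where
    later : ∀ a → Fin.suc (Fin.zero {m}) Fin.< lookup (Vec.map Fin.suc (Vec.map Fin.suc w′)) a
    later a rewrite Vec.lookup-map a Fin.suc (Vec.map Fin.suc w′) | Vec.lookup-map a Fin.suc w′ = s≤s (s≤s z≤n)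

is21-3-count : ∀ l (ys : Vec ℕ m) → Is21-3 {l = l} ys HasCard 21-3-count l (toList ys)
is21-3-count l []           = HasCard-∅ λ { (() ∷ _) }
is21-3-count l (y ∷ [])     = HasCard-∅ λ { (zero ∷ zero ∷ _) (() , _) }
is21-3-count l (y ∷ y′ ∷ ys) = HasCard-⊎
  (HasCard-Image (Vec.map Fin.suc) map-suc-injective (is21-3-count l (y′ ∷ ys)))
  (HasCard-Image (λ w → zero ∷ suc zero ∷ Vec.map Fin.suc (Vec.map Fin.suc w))
    (map-suc-injective ∘ map-suc-injective ∘ Vec.∷-injectiveʳ ∘ Vec.∷-injectiveʳ)
    (HasCard-when (y′ ℕ.<? y) (increasingAbove-count l y ys)))
  (is21-3-split y y′ ys)
  λ { _ (_ ∷ _ , _ , refl) (_ , _ , ()) }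

-- The letters of a pattern are distinct, so by trichotomy a strictly monotone assignment also
-- reflects the order.
letters-mono⇒⇔ : (τ : Permutation′ m) (v : Fin m → ℕ) →
  (∀ a b → τ ⟨$⟩ʳ a Fin.< τ ⟨$⟩ʳ b → v a ℕ.< v b) →
  ∀ a b → (τ ⟨$⟩ʳ a Fin.< τ ⟨$⟩ʳ b) ⇔ (v a ℕ.< v b)
letters-mono⇒⇔ τ v mono a b = mk⇔ (mono a b) reflect
  where
  reflect : v a ℕ.< v b → τ ⟨$⟩ʳ a Fin.< τ ⟨$⟩ʳ b
  reflect va<vb with Fin.<-cmp (τ ⟨$⟩ʳ a) (τ ⟨$⟩ʳ b)
  ... | tri< lt _ _ = lt
  ... | tri≈ _ eq _ = contradiction (cong v (trans (sym (inverseˡ τ)) (trans (cong (τ ⟨$⟩ˡ_) eq) (inverseˡ τ)))) (ℕ.<⇒≢ va<vb)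
  ... | tri> _ _ gt = contradiction (mono b a gt) (ℕ.<-asym va<vb)

values : Vec (Fin n) m → Vec ℕ m
values = Vec.map toℕ

module _ (π : Vec (Fin n) n) where

  private
    lookup-values : ∀ i → lookup (values π) i ≡ toℕ (lookup π i)
    lookup-values i = Vec.lookup-map i toℕ π

    to-values : ∀ {i j} → lookup π i Fin.< lookup π j → lookup (values π) i ℕ.< lookup (values π) j
    to-values {i} {j} = subst₂ ℕ._<_ (sym (lookup-values i)) (sym (lookup-values j))

    from-values : ∀ {i j} → lookup (values π) i ℕ.< lookup (values π) j → lookup π i Fin.< lookup π j
    from-values {i} {j} = subst₂ ℕ._<_ (lookup-values i) (lookup-values j)

  occurrence⇔is21-3 : ∀ (w : Vec (Fin n) (suc (suc l))) → IsOccurrence (21-3-⋯- (suc (suc l))) π w ⇔ Is21-3 (values π) w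
  occurrence⇔is21-3 {l} (i ∷ j ∷ w) = mk⇔ forward backward
    where
    forward : IsOccurrence (21-3-⋯- _) π (i ∷ j ∷ w) → Is21-3 (values π) (i ∷ j ∷ w)
    forward (positions , letters , adjacent) =
      adjacent zero (suc zero) refl refl ,
      -- The first two letters are swapped: position `zero` carries letter 1 and position `suc zero`
      -- carries letter 0.
      to-values (to (letters (suc zero) zero) (s≤s z≤n)) ,
      (λ a → positions (suc zero) (suc (suc a)) (s≤s (s≤s z≤n))) ,
      (λ a → to-values (to (letters zero (suc (suc a))) (s≤s (s≤s z≤n)))) ,
      (λ a b a<b → positions (suc (suc a)) (suc (suc b)) (s≤s (s≤s a<b)) ,
                   to-values (to (letters (suc (suc a)) (suc (suc b))) (s≤s (s≤s a<b))))
    backward : Is21-3 (values π) (i ∷ j ∷ w) → IsOccurrence (21-3-⋯- _) π (i ∷ j ∷ w)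
    backward (j≡1+i , πj<πi , j<w , πi<w , inc) =
      positions , letters-mono⇒⇔ (Pattern.letters (21-3-⋯- (suc (suc l)))) (λ a → toℕ (lookup π (lookup (i ∷ j ∷ w) a))) letters , adjacent
      where
      i<j : i Fin.< j
      i<j = ℕ.≤-reflexive (sym j≡1+i)
      positions : ∀ a b → a Fin.< b → lookup (i ∷ j ∷ w) a Fin.< lookup (i ∷ j ∷ w) b
      positions zero          (suc zero)    _               = i<j
      positions zero          (suc (suc b)) _               = ℕ.<-trans i<j (j<w b)
      positions (suc zero)    (suc (suc b)) _               = j<w b
      positions (suc zero)    (suc zero)    (s≤s ())
      positions (suc (suc a)) (suc zero)    (s≤s ())
      positions (suc (suc a)) (suc (suc b)) (s≤s (s≤s a<b)) = proj₁ (inc a b a<b)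
      letters : ∀ a b → _ → toℕ (lookup π (lookup (i ∷ j ∷ w) a)) ℕ.< toℕ (lookup π (lookup (i ∷ j ∷ w) b))
      letters zero          zero          (s≤s ())
      letters zero          (suc zero)    ()
      letters zero          (suc (suc b)) _               = from-values (πi<w b)
      letters (suc zero)    zero          _               = from-values πj<πi
      letters (suc zero)    (suc zero)    ()
      letters (suc zero)    (suc (suc b)) _               = ℕ.<-trans (from-values πj<πi) (from-values (πi<w b))
      letters (suc (suc a)) zero          (s≤s ())
      letters (suc (suc a)) (suc zero)    ()
      letters (suc (suc a)) (suc (suc b)) (s≤s (s≤s a<b)) = from-values (proj₂ (inc a b a<b))
      adjacent : ∀ a b → toℕ b ≡ suc (toℕ a) → _ → toℕ (lookup (i ∷ j ∷ w) b) ≡ suc (toℕ (lookup (i ∷ j ∷ w) a))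
      adjacent zero    (suc zero) _ _ = j≡1+i
      adjacent (suc a) _          _ ()

  occurrence⇔132 : ∀ i j k → IsOccurrence 1-3-2 π (i ∷ j ∷ k ∷ []) ⇔
    (i Fin.< j × j Fin.< k × lookup (values π) i ℕ.< lookup (values π) k × lookup (values π) k ℕ.< lookup (values π) j)
  occurrence⇔132 i j k = mk⇔ forward backward
    where
    w = i ∷ j ∷ k ∷ []
    forward : IsOccurrence 1-3-2 π w → _
    forward (positions , letters , _) =
      positions zero (suc zero) (s≤s z≤n) , positions (suc zero) (suc (suc zero)) (s≤s (s≤s z≤n)) ,
      to-values (to (letters zero (suc (suc zero))) (s≤s z≤n)) ,
      to-values (to (letters (suc (suc zero)) (suc zero)) (s≤s (s≤s z≤n)))
    backward : _ → IsOccurrence 1-3-2 π w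
    backward (i<j , j<k , πi<πk , πk<πj) =
      positions , letters-mono⇒⇔ (Pattern.letters 1-3-2) (λ a → toℕ (lookup π (lookup w a))) letters , λ _ _ _ ()
      where
      positions : ∀ a b → a Fin.< b → lookup w a Fin.< lookup w b
      positions zero             (suc zero)       _ = i<j
      positions zero             (suc (suc zero)) _ = ℕ.<-trans i<j j<k
      positions (suc zero)       (suc zero)       (s≤s ())
      positions (suc zero)       (suc (suc zero)) _ = j<k
      positions (suc (suc zero)) (suc zero)       (s≤s ())
      positions (suc (suc zero)) (suc (suc zero)) (s≤s (s≤s ()))
      letters : ∀ a b → _ → toℕ (lookup π (lookup w a)) ℕ.< toℕ (lookup π (lookup w b))
      letters zero             zero             ()
      letters zero             (suc zero)       _ = ℕ.<-trans (from-values πi<πk) (from-values πk<πj)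
      letters zero             (suc (suc zero)) _ = from-values πi<πk
      letters (suc zero)       zero             ()
      letters (suc zero)       (suc zero)       (s≤s (s≤s ()))
      letters (suc zero)       (suc (suc zero)) (s≤s ())
      letters (suc (suc zero)) zero             ()
      letters (suc (suc zero)) (suc zero)       _ = from-values πk<πj
      letters (suc (suc zero)) (suc (suc zero)) (s≤s ())

  IsOccurrence-count : ∀ {k} (τ : Pattern k) → IsOccurrence τ π HasCard occurrences τ π
  IsOccurrence-count τ = HasCard-filter (isOccurrence? τ π) (words-unique _ _) (λ w _ → words-complete w)

  occurrences-21-3 : ∀ l → occurrences (21-3-⋯- (suc (suc l))) π ≡ 21-3-count l (toList (values π))
  occurrences-21-3 l = HasCard-unique (IsOccurrence-count (21-3-⋯- (suc (suc l))))
    (HasCard-⇔ (is21-3-count l (values π)) (λ w → mk⇔ (from (occurrence⇔is21-3 w)) (to (occurrence⇔is21-3 w))))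

-- Permutations coded by trees

permutation : Tree → List ℕ
permutation leaf       = []
permutation (node l r) = map (size r ℕ.+_) (permutation l) ++ (size l ℕ.+ size r) ∷ permutation r

Avoids132 : List ℕ → Set
Avoids132 []       = ⊤
Avoids132 (x ∷ xs) = AllPairs (λ b c → ¬ (x ℕ.< c × c ℕ.< b)) xs × Avoids132 xs

IsPermutation : ℕ → List ℕ → Set
IsPermutation n xs = length xs ≡ n × All (ℕ._< n) xs × Unique xs

-- Occurrence counts on both sides of the maximum.

NotAbove : ℕ → List ℕ → Set
NotAbove v = All (λ c → ¬ (v ℕ.< c))

when-+ : ∀ {P : Set} (P? : Dec P) a b → when P? (a ℕ.+ b) ≡ when P? a ℕ.+ when P? b
when-+ (yes _) a b = refl
when-+ (no _)  a b = refl

when-zero : ∀ {P : Set} (P? : Dec P) → when P? 0 ≡ 0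
when-zero (yes _) = refl
when-zero (no _)  = refl

when-cong : ∀ {P : Set} (P? : Dec P) {a b} → (P → a ≡ b) → when P? a ≡ when P? b
when-cong (yes P) eq = eq P
when-cong (no _)  _  = refl

increasing-above-none : ∀ l {v} → NotAbove v xs → increasing-above (suc l) v xs ≡ 0
increasing-above-none l []                     = refl
increasing-above-none l {v} (_∷_ {x} v≮x v≮xs) =
  cong₂ ℕ._+_ (increasing-above-none l v≮xs) (when-no (v ℕ.<? x) v≮x)

<-notAbove : ∀ {v w} → v ℕ.< w → NotAbove v xs → NotAbove w xs
<-notAbove v<w = All.map (λ v≮c w<c → v≮c (ℕ.<-trans v<w w<c))

-- No letter of `R` exceeds `v`, so a selection lies in `L` or consists of a selection in `L`,
-- shorter by one, followed by `N`.
increasing-above-split : ∀ l {v} → All (ℕ._< N) L → v ℕ.< N → NotAbove v R →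
  increasing-above (suc l) v (L ++ N ∷ R) ≡ increasing-above (suc l) v L ℕ.+ increasing-above l v L
increasing-above-split {N} {R = R} l {v} [] v<N v≮R = begin
  increasing-above (suc l) v R ℕ.+ when (v ℕ.<? N) (increasing-above l N R)
    ≡⟨ cong₂ ℕ._+_ (increasing-above-none l v≮R) (when-yes (v ℕ.<? N) v<N) ⟩
  increasing-above l N R      ≡⟨ after l ⟩
  increasing-above l v []     ∎
  where
  open ≡-Reasoning
  after : ∀ l → increasing-above l N R ≡ increasing-above l v []
  after zero    = refl
  after (suc l) = increasing-above-none l (<-notAbove v<N v≮R)
increasing-above-split {N} {x ∷ L} {R} zero {v} (x<N ∷ L<N) v<N v≮R = begin
  increasing-above 1 v (L ++ N ∷ R) ℕ.+ w   ≡⟨ cong (ℕ._+ w) (increasing-above-split zero L<N v<N v≮R) ⟩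
  increasing-above 1 v L ℕ.+ 1 ℕ.+ w        ≡⟨ solve 2 (λ a w → a :+ con 1 :+ w := a :+ w :+ con 1) refl (increasing-above 1 v L) w ⟩
  increasing-above 1 v L ℕ.+ w ℕ.+ 1        ∎
  where
  open ≡-Reasoning
  open +-*-Solver
  w = when (v ℕ.<? x) 1
increasing-above-split {N} {x ∷ L} {R} (suc l) {v} (x<N ∷ L<N) v<N v≮R = begin
  increasing-above (suc (suc l)) v (L ++ N ∷ R) ℕ.+ when v<?x (increasing-above (suc l) x (L ++ N ∷ R))
    ≡⟨ cong₂ ℕ._+_ (increasing-above-split (suc l) L<N v<N v≮R)
         (trans (when-cong v<?x (λ v<x → increasing-above-split l L<N x<N (<-notAbove v<x v≮R)))
                (when-+ v<?x (increasing-above (suc l) x L) (increasing-above l x L))) ⟩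
  (increasing-above (suc (suc l)) v L ℕ.+ increasing-above (suc l) v L) ℕ.+
  (when v<?x (increasing-above (suc l) x L) ℕ.+ when v<?x (increasing-above l x L))
    ≡⟨ solve 4 (λ a b c d → (a :+ b) :+ (c :+ d) := (a :+ c) :+ (b :+ d)) refl (increasing-above (suc (suc l)) v L) (increasing-above (suc l) v L) _ _ ⟩
  (increasing-above (suc (suc l)) v L ℕ.+ when v<?x (increasing-above (suc l) x L)) ℕ.+
  (increasing-above (suc l) v L ℕ.+ when v<?x (increasing-above l x L)) ∎
  where
  open ≡-Reasoning
  open +-*-Solver
  v<?x = v ℕ.<? x

21-3-count-max∷ : ∀ l → NotAbove N R → 21-3-count (suc l) (N ∷ R) ≡ 21-3-count (suc l) R
21-3-count-max∷ l []                            = refl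
21-3-count-max∷ {N} l (_∷_ {y} {R} _ N≮R) = trans
  (cong (21-3-count (suc l) (y ∷ R) ℕ.+_)
    (trans (cong (when (y ℕ.<? N)) (increasing-above-none l N≮R)) (when-zero (y ℕ.<? N))))
  (ℕ.+-identityʳ _)

-- A descent in `L` finds its larger letters in `L`, with `N` possibly as the last one: this gives
-- the first two terms. A descent from `N` finds no larger letter, and there is no descent into `N`.
21-3-count-split : ∀ l → All (ℕ._< N) L → NotAbove N R → All (λ x → NotAbove x R) L →
  21-3-count (suc l) (L ++ N ∷ R) ≡ 21-3-count (suc l) L ℕ.+ 21-3-count l L ℕ.+ 21-3-count (suc l) R
21-3-count-split l []                N≮R _             = 21-3-count-max∷ l N≮R
21-3-count-split {N} {R = R} l (_∷_ {x} x<N []) N≮R _  = begin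
  21-3-count (suc l) (N ∷ R) ℕ.+ when (N ℕ.<? x) (increasing-above (suc l) x R)
    ≡⟨ cong₂ ℕ._+_ (21-3-count-max∷ l N≮R) (when-no (N ℕ.<? x) (ℕ.<-asym x<N)) ⟩
  21-3-count (suc l) R ℕ.+ 0   ≡⟨ ℕ.+-identityʳ _ ⟩
  21-3-count (suc l) R         ∎
  where open ≡-Reasoning
21-3-count-split {N} {x ∷ y ∷ L} {R} l (x<N ∷ y∷L<N@(_ ∷ L<N)) N≮R (x≮R ∷ y∷L≮R) = begin
  21-3-count (suc l) (y ∷ L ++ N ∷ R) ℕ.+ when y<?x (increasing-above (suc l) x (L ++ N ∷ R))
    ≡⟨ cong₂ ℕ._+_ (21-3-count-split l y∷L<N N≮R y∷L≮R)
         (trans (cong (when y<?x) (increasing-above-split l L<N x<N x≮R))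
                (when-+ y<?x (increasing-above (suc l) x L) (increasing-above l x L))) ⟩
  (a ℕ.+ b ℕ.+ c) ℕ.+ (d ℕ.+ e)
    ≡⟨ solve 5 (λ a b c d e → (a :+ b :+ c) :+ (d :+ e) := (a :+ d) :+ (b :+ e) :+ c) refl a b c d e ⟩
  (a ℕ.+ d) ℕ.+ (b ℕ.+ e) ℕ.+ c ∎
  where
  open ≡-Reasoning
  open +-*-Solver
  y<?x = y ℕ.<? x
  a = 21-3-count (suc l) (y ∷ L)
  b = 21-3-count l (y ∷ L)
  c = 21-3-count (suc l) R
  d = when y<?x (increasing-above (suc l) x L)
  e = when y<?x (increasing-above l x L)

nonempty : List ℕ → ℕ
nonempty []      = 0
nonempty (_ ∷ _) = 1

-- Without any later letter in the pattern, the descent from `N` to the head of `R` does count; this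
-- case needs its own formula.
descents-split : All (ℕ._< N) L → All (ℕ._< N) R →
  21-3-count 0 (L ++ N ∷ R) ≡ 21-3-count 0 L ℕ.+ (nonempty R ℕ.+ 21-3-count 0 R)
descents-split []               []          = refl
descents-split {N} []           (_∷_ {y} {R} y<N _) = trans
  (cong (21-3-count 0 (y ∷ R) ℕ.+_) (when-yes (y ℕ.<? N) y<N)) (ℕ.+-comm _ 1)
descents-split {N} (_∷_ {x} x<N []) R<N     = trans
  (cong₂ ℕ._+_ (descents-split [] R<N) (when-no (N ℕ.<? x) (ℕ.<-asym x<N))) (ℕ.+-identityʳ _)
descents-split {N} {x ∷ y ∷ L} {R} (x<N ∷ y∷L<N) R<N = begin
  21-3-count 0 (y ∷ L ++ N ∷ R) ℕ.+ w      ≡⟨ cong (ℕ._+ w) (descents-split y∷L<N R<N) ⟩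
  21-3-count 0 (y ∷ L) ℕ.+ c ℕ.+ w         ≡⟨ solve 3 (λ a c w → a :+ c :+ w := a :+ w :+ c) refl (21-3-count 0 (y ∷ L)) c w ⟩
  21-3-count 0 (y ∷ L) ℕ.+ w ℕ.+ c         ∎
  where
  open ≡-Reasoning
  open +-*-Solver
  w = when (y ℕ.<? x) 1
  c = nonempty R ℕ.+ 21-3-count 0 R

when-<-shift : ∀ s x y a → when (s ℕ.+ x ℕ.<? s ℕ.+ y) a ≡ when (x ℕ.<? y) a
when-<-shift s x y a = shift (x ℕ.<? y)
  where
  shift : (x<?y : Dec (x ℕ.< y)) → when (s ℕ.+ x ℕ.<? s ℕ.+ y) a ≡ when x<?y a
  shift (yes x<y) = when-yes (s ℕ.+ x ℕ.<? s ℕ.+ y) (ℕ.+-monoʳ-< s x<y)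
  shift (no x≮y)  = when-no (s ℕ.+ x ℕ.<? s ℕ.+ y) (x≮y ∘ ℕ.+-cancelˡ-< s x y)

increasing-above-shift : ∀ s l v xs → increasing-above l (s ℕ.+ v) (map (s ℕ.+_) xs) ≡ increasing-above l v xs
increasing-above-shift s zero    v xs       = refl
increasing-above-shift s (suc l) v []       = refl
increasing-above-shift s (suc l) v (x ∷ xs) = cong₂ ℕ._+_ (increasing-above-shift s (suc l) v xs)
  (trans (when-<-shift s v x _) (cong (when (v ℕ.<? x)) (increasing-above-shift s l x xs)))

21-3-count-shift : ∀ s l xs → 21-3-count l (map (s ℕ.+_) xs) ≡ 21-3-count l xs
21-3-count-shift s l []           = refl
21-3-count-shift s l (x ∷ [])     = refl
21-3-count-shift s l (x ∷ y ∷ xs) = cong₂ ℕ._+_ (21-3-count-shift s l (y ∷ xs))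
  (trans (when-<-shift s y x _) (cong (when (y ℕ.<? x)) (increasing-above-shift s l x xs)))

weight-zero : ∀ d e t → weight 0 d t ≡ weight 0 e t
weight-zero d e leaf       = refl
weight-zero d e (node l r) = cong₂ ℕ._+_ (weight-zero (suc d) (suc e) l) (cong (unless-leaf r 1 ℕ.+_) (weight-zero d e r))

-- Hanging a tree one left step lower raises the depth of each of its nodes by one, and Pascal's
-- rule applies node by node. This mirrors the first two terms of `21-3-count-split`.
weight-pascal : ∀ j d t → weight (suc j) (suc d) t ≡ weight (suc j) d t ℕ.+ weight j d t
weight-pascal j d leaf       = refl
weight-pascal j d (node l r) = begin
  weight (suc j) (suc (suc d)) l ℕ.+ (unless-leaf r (suc d C suc j) ℕ.+ weight (suc j) (suc d) r)
    ≡⟨ cong₂ ℕ._+_ (weight-pascal j (suc d) l) (cong₂ ℕ._+_ (pascal r) (weight-pascal j d r)) ⟩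
  (a ℕ.+ b) ℕ.+ ((c ℕ.+ e) ℕ.+ (g ℕ.+ h))
    ≡⟨ solve 6 (λ a b c e g h → (a :+ b) :+ ((c :+ e) :+ (g :+ h)) := (a :+ (c :+ g)) :+ (b :+ (e :+ h))) refl a b c e g h ⟩
  (a ℕ.+ (c ℕ.+ g)) ℕ.+ (b ℕ.+ (e ℕ.+ h)) ∎
  where
  open ≡-Reasoning
  open +-*-Solver
  a = weight (suc j) (suc d) l
  b = weight j (suc d) l
  c = unless-leaf r (d C suc j)
  e = unless-leaf r (d C j)
  g = weight (suc j) d r
  h = weight j d r
  pascal : ∀ r → unless-leaf r (suc d C suc j) ≡ unless-leaf r (d C suc j) ℕ.+ unless-leaf r (d C j)
  pascal leaf       = refl
  pascal (node _ _) = trans (sym (nCk+nC[k+1]≡[n+1]C[k+1] d j)) (ℕ.+-comm (d C j) (d C suc j))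

-- Trees give 1-3-2-avoiding permutations, injectively.

permutation-length : ∀ t → length (permutation t) ≡ size t
permutation-length leaf       = refl
permutation-length (node l r) = begin
  length (map (size r ℕ.+_) (permutation l) ++ _ ∷ permutation r)
    ≡⟨ List.length-++ (map (size r ℕ.+_) (permutation l)) ⟩
  length (map (size r ℕ.+_) (permutation l)) ℕ.+ suc (length (permutation r))
    ≡⟨ cong₂ ℕ._+_ (trans (List.length-map _ (permutation l)) (permutation-length l)) (cong suc (permutation-length r)) ⟩
  size l ℕ.+ suc (size r)     ≡⟨ ℕ.+-suc (size l) (size r) ⟩
  suc (size l ℕ.+ size r)     ∎
  where open ≡-Reasoning

permutation-bounded : ∀ t → All (ℕ._< size t) (permutation t)

left-bounded : ∀ l r → All (ℕ._< size l ℕ.+ size r) (map (size r ℕ.+_) (permutation l))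
left-bounded l r = All.map⁺ (All.map
  (λ {x} x<l → subst (size r ℕ.+ x ℕ.<_) (ℕ.+-comm (size r) (size l)) (ℕ.+-monoʳ-< (size r) x<l))
  (permutation-bounded l))

right-bounded : ∀ l r → All (ℕ._< size l ℕ.+ size r) (permutation r)
right-bounded l r = All.map (λ x<r → ℕ.<-≤-trans x<r (ℕ.m≤n+m (size r) (size l))) (permutation-bounded r)

permutation-bounded leaf       = []
permutation-bounded (node l r) = All.++⁺ (All.map ℕ.m<n⇒m<1+n (left-bounded l r))
  (ℕ.≤-refl ∷ All.map ℕ.m<n⇒m<1+n (right-bounded l r))

right<left : ∀ l r → All (λ x → All (ℕ._< x) (permutation r)) (map (size r ℕ.+_) (permutation l))
right<left l r = All.map⁺ (All.universal
  (λ x → All.map (λ y<r → ℕ.<-≤-trans y<r (ℕ.m≤m+n (size r) x)) (permutation-bounded r)) (permutation l))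

permutation-unique : ∀ t → Unique (permutation t)
permutation-unique leaf       = []
permutation-unique (node l r) = AllPairs.++⁺
  (Unique.map⁺ (ℕ.+-cancelˡ-≡ (size r) _ _) (permutation-unique l))
  (All.map (λ x<N eq → ℕ.<⇒≢ x<N (sym eq)) (right-bounded l r) ∷ permutation-unique r)
  (All.zipWith (λ (x<N , R<x) → ℕ.<⇒≢ x<N ∷ All.map (λ y<x eq → ℕ.<⇒≢ y<x (sym eq)) R<x)
    (left-bounded l r , right<left l r))

permutation-isPermutation : ∀ t → IsPermutation (size t) (permutation t)
permutation-isPermutation t = permutation-length t , permutation-bounded t , permutation-unique t

allPairs-second : ∀ {P : ℕ → Set} {Q : ℕ → ℕ → Set} → (∀ {b c} → P c → Q b c) → All P xs → AllPairs Q xs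
allPairs-second P⇒Q []         = []
allPairs-second P⇒Q (_ ∷ Pxs) = All.map P⇒Q Pxs ∷ allPairs-second P⇒Q Pxs

-- In an occurrence across the blocks the 2 cannot be `N`, which exceeds the candidate 3, nor a
-- letter of `R` after a 1 in `L`, which lies above `R`; and `N` cannot be the 1.
avoids132-++ : Avoids132 L → Avoids132 R → All (ℕ._< N) L → All (ℕ._< N) R → All (λ x → All (ℕ._< x) R) L →
               Avoids132 (L ++ N ∷ R)
avoids132-++ {[]}    _             R-avoids _           R<N _           =
  allPairs-second (λ c<N (N<c , _) → ℕ.<-asym c<N N<c) R<N , R-avoids
avoids132-++ {x ∷ L} {R} {N} (x-avoids , L-avoids) R-avoids (x<N ∷ L<N) R<N (R<x ∷ R<L) =
  AllPairs.++⁺ x-avoids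
    (All.map (λ c<x (x<c , _) → ℕ.<-asym c<x x<c) R<x ∷ allPairs-second (λ c<x (x<c , _) → ℕ.<-asym c<x x<c) R<x)
    (All.map (λ b<N → (λ (_ , N<b) → ℕ.<-asym b<N N<b) ∷ All.map (λ c<x (x<c , _) → ℕ.<-asym c<x x<c) R<x) L<N) ,
  avoids132-++ L-avoids R-avoids L<N R<N R<L

avoids132-shift⁺ : ∀ s → Avoids132 xs → Avoids132 (map (s ℕ.+_) xs)
avoids132-shift⁺ {[]}     s _             = tt
avoids132-shift⁺ {x ∷ xs} s (x-avoids , xs-avoids) =
  AllPairs.map⁺ (AllPairs.map (λ ¬132 (x<c , c<b) → ¬132 (ℕ.+-cancelˡ-< s _ _ x<c , ℕ.+-cancelˡ-< s _ _ c<b)) x-avoids) ,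
  avoids132-shift⁺ s xs-avoids

avoids132-shift⁻ : ∀ s → Avoids132 (map (s ℕ.+_) xs) → Avoids132 xs
avoids132-shift⁻ {[]}     s _             = tt
avoids132-shift⁻ {x ∷ xs} s (x-avoids , xs-avoids) =
  AllPairs.map (λ ¬132 (x<c , c<b) → ¬132 (ℕ.+-monoʳ-< s x<c , ℕ.+-monoʳ-< s c<b)) (AllPairs.map⁻ x-avoids) ,
  avoids132-shift⁻ s xs-avoids

permutation-avoids132 : ∀ t → Avoids132 (permutation t)
permutation-avoids132 leaf       = tt
permutation-avoids132 (node l r) = avoids132-++ (avoids132-shift⁺ (size r) (permutation-avoids132 l))
  (permutation-avoids132 r) (left-bounded l r) (right-bounded l r) (right<left l r)

-- For positive `j` the left block is needed at both `j` and its predecessor, and `weight-pascal`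
-- merges the two into one weight at depth 1. At `j` = 0 the root may contribute a descent itself,
-- since `0 C 0` is 1.
permutation-21-3-count : ∀ j t → 21-3-count j (permutation t) ≡ weight j 0 t
permutation-21-3-count j       leaf       = refl
permutation-21-3-count zero    (node l r) = begin
  21-3-count 0 (map (size r ℕ.+_) (permutation l) ++ _ ∷ permutation r)
    ≡⟨ descents-split (left-bounded l r) (right-bounded l r) ⟩
  21-3-count 0 (map (size r ℕ.+_) (permutation l)) ℕ.+ (nonempty (permutation r) ℕ.+ 21-3-count 0 (permutation r))
    ≡⟨ cong₂ ℕ._+_ (trans (21-3-count-shift (size r) 0 (permutation l)) (trans (permutation-21-3-count 0 l) (weight-zero 0 1 l)))
         (cong₂ ℕ._+_ (nonempty-permutation r) (permutation-21-3-count 0 r)) ⟩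
  weight 0 1 l ℕ.+ (unless-leaf r 1 ℕ.+ weight 0 0 r) ∎
  where
  open ≡-Reasoning
  nonempty-++∷ : ∀ xs {x ys} → nonempty (xs ++ x ∷ ys) ≡ 1
  nonempty-++∷ []      = refl
  nonempty-++∷ (_ ∷ _) = refl
  nonempty-permutation : ∀ t → nonempty (permutation t) ≡ unless-leaf t 1
  nonempty-permutation leaf       = refl
  nonempty-permutation (node l r) = nonempty-++∷ (map (size r ℕ.+_) (permutation l))
permutation-21-3-count (suc j) (node l r) = begin
  21-3-count (suc j) (ls ++ _ ∷ permutation r)
    ≡⟨ 21-3-count-split j (left-bounded l r) (All.map ℕ.<-asym (right-bounded l r))
         (All.map (All.map ℕ.<-asym) (right<left l r)) ⟩
  21-3-count (suc j) ls ℕ.+ 21-3-count j ls ℕ.+ 21-3-count (suc j) (permutation r)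
    ≡⟨ cong₂ ℕ._+_ (cong₂ ℕ._+_ (left (suc j)) (left j)) (permutation-21-3-count (suc j) r) ⟩
  weight (suc j) 0 l ℕ.+ weight j 0 l ℕ.+ weight (suc j) 0 r
    ≡⟨ cong₂ ℕ._+_ (weight-pascal j 0 l) (no-root-weight r) ⟨
  weight (suc j) 1 l ℕ.+ (unless-leaf r (0 C suc j) ℕ.+ weight (suc j) 0 r) ∎
  where
  open ≡-Reasoning
  ls = map (size r ℕ.+_) (permutation l)
  left : ∀ i → 21-3-count i ls ≡ weight i 0 l
  left i = trans (21-3-count-shift (size r) i (permutation l)) (permutation-21-3-count i l)
  no-root-weight : ∀ r → unless-leaf r (0 C suc j) ℕ.+ weight (suc j) 0 r ≡ weight (suc j) 0 r
  no-root-weight leaf       = refl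
  no-root-weight (node _ _) = refl

++∷-injective : ∀ {z} L L′ {R R′ : List ℕ} → All (_≢ z) L → All (_≢ z) L′ →
                L ++ z ∷ R ≡ L′ ++ z ∷ R′ → L ≡ L′ × R ≡ R′
++∷-injective []      []        _           _              eq = refl , List.∷-injectiveʳ eq
++∷-injective []      (y ∷ L′)  _           (y≢z ∷ _)      eq = contradiction (sym (List.∷-injectiveˡ eq)) y≢z
++∷-injective (x ∷ L) []        (x≢z ∷ _)   _              eq = contradiction (List.∷-injectiveˡ eq) x≢z
++∷-injective (x ∷ L) (y ∷ L′)  (_ ∷ L≢z)   (_ ∷ L′≢z)     eq
  with refl , eq′ ← List.∷-injective eq
  with refl , R≡R′ ← ++∷-injective L L′ L≢z L′≢z eq′ = refl , R≡R′

permutation-injective : ∀ t t′ → permutation t ≡ permutation t′ → t ≡ t′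
permutation-injective leaf       leaf         _  = refl
permutation-injective leaf       t′@(node _ _) eq
  with () ← trans (cong length eq) (permutation-length t′)
permutation-injective t@(node _ _) leaf       eq
  with () ← trans (sym (permutation-length t)) (cong length eq)
permutation-injective t@(node l r) t′@(node l′ r′) eq
  with N≡N′ ← ℕ.suc-injective (trans (sym (permutation-length t)) (trans (cong length eq) (permutation-length t′)))
  with L≡L′ , R≡R′ ← ++∷-injective _ _
         (All.map ℕ.<⇒≢ (left-bounded l r))
         (All.map (λ x<N′ x≡N → ℕ.<⇒≢ x<N′ (trans x≡N N≡N′)) (left-bounded l′ r′))
         (trans eq (cong (λ z → map (size r′ ℕ.+_) (permutation l′) ++ z ∷ permutation r′) (sym N≡N′)))
  -- The right subtree comes first: the left blocks are shifted by `size r` and `size r′`, and the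
  -- shift cancels only once these agree.
  with refl ← permutation-injective r r′ R≡R′
  = cong (λ l → node l r) (permutation-injective l l′ (List.map-injective (ℕ.+-cancelˡ-≡ (size r) _ _) L≡L′))

-- Surjectivity of the coding: splitting at the maximum.

lookup-injective : Unique xs → ∀ i j → List.lookup xs i ≡ List.lookup xs j → i ≡ j
lookup-injective (_ ∷ _)   zero    zero    _  = refl
lookup-injective {_ ∷ xs} (x≢ ∷ _) zero (suc j) eq = contradiction eq (All.lookup x≢ (∈-lookup j))
lookup-injective {_ ∷ xs} (x≢ ∷ _) (suc i) zero eq = contradiction (sym eq) (All.lookup x≢ (∈-lookup i))
lookup-injective (_ ∷ xs!) (suc i) (suc j) eq = cong suc (lookup-injective xs! i j eq)

unique-bounded⇒length≤ : Unique xs → All (ℕ._< n) xs → length xs ℕ.≤ n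
unique-bounded⇒length≤ {xs} {n} xs! xs<n = Fin.injective⇒≤ {f = index} λ {i} {j} eq →
  lookup-injective xs! i j (trans (sym (Fin.toℕ-fromℕ< (bound i))) (trans (cong toℕ eq) (Fin.toℕ-fromℕ< (bound j))))
  where
  bound : ∀ i → List.lookup xs i ℕ.< n
  bound i = All.lookup xs<n (∈-lookup i)
  index : Fin (length xs) → Fin n
  index i = Fin.fromℕ< (bound i)

-- Otherwise n + 1 distinct letters would all lie below n, against the pigeonhole principle.
max∈permutation : IsPermutation (suc n) xs → n ∈ xs
max∈permutation {n} {xs} (len , xs<1+n , xs!) with n ∈? xs
... | yes n∈xs = n∈xs
... | no  n∉xs = contradiction (subst (ℕ._≤ n) len (unique-bounded⇒length≤ xs! xs<n)) ℕ.1+n≰n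
  where
  xs<n : All (ℕ._< n) xs
  xs<n = All.tabulate λ x∈xs → ℕ.≤∧≢⇒< (ℕ.≤-pred (All.lookup xs<1+n x∈xs)) λ { refl → n∉xs x∈xs }

allPairs-++⁻ʳ : ∀ {Q : ℕ → ℕ → Set} xs → AllPairs Q (xs ++ ys) → AllPairs Q ys
allPairs-++⁻ʳ []       p       = p
allPairs-++⁻ʳ (_ ∷ xs) (_ ∷ p) = allPairs-++⁻ʳ xs p

allPairs-++⁻ˡ : ∀ {Q : ℕ → ℕ → Set} xs → AllPairs Q (xs ++ ys) → AllPairs Q xs
allPairs-++⁻ˡ []       p       = []
allPairs-++⁻ˡ (_ ∷ xs) (q ∷ p) = All.++⁻ˡ xs q ∷ allPairs-++⁻ˡ xs p

allPairs-++⁻ : ∀ {Q : ℕ → ℕ → Set} xs → AllPairs Q (xs ++ ys) → All (λ x → All (Q x) ys) xs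
allPairs-++⁻ []       p       = []
allPairs-++⁻ (_ ∷ xs) (q ∷ p) = All.++⁻ʳ xs q ∷ allPairs-++⁻ xs p

avoids132-++⁻ˡ : ∀ xs → Avoids132 (xs ++ ys) → Avoids132 xs
avoids132-++⁻ˡ []       _       = tt
avoids132-++⁻ˡ (x ∷ xs) (p , q) = allPairs-++⁻ˡ xs p , avoids132-++⁻ˡ xs q

avoids132-++⁻ʳ : ∀ xs → Avoids132 (xs ++ ys) → Avoids132 ys
avoids132-++⁻ʳ []       q       = q
avoids132-++⁻ʳ (x ∷ xs) (p , q) = avoids132-++⁻ʳ xs q

-- If x in `L` were below c in `R`, then x, `N`, c would form 1-3-2.
avoids132-max : ∀ L → Avoids132 (L ++ N ∷ R) → Unique (L ++ N ∷ R) → All (ℕ._< N) R → All (λ x → All (ℕ._< x) R) L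
avoids132-max []      _       _        _   = []
avoids132-max {N} {R} (x ∷ L) (p , q) (x≢ ∷ u) R<N
  with N-pairs ∷ _ ← allPairs-++⁻ʳ L p | _ ∷ x≢R ← All.++⁻ʳ L x≢ =
  All.zipWith (λ (¬132 , c<N , x≢c) → ℕ.≤∧≢⇒< (ℕ.≮⇒≥ (λ x<c → ¬132 (x<c , c<N))) (x≢c ∘ sym))
    (N-pairs , All.zip (R<N , x≢R)) ∷
  avoids132-max L q u R<N

module _ {N : ℕ} {L R : List ℕ} (perm : IsPermutation (suc N) (L ++ N ∷ R)) (R<L : All (λ x → All (ℕ._< x) R) L) where

  private
    unique   = proj₂ (proj₂ perm)
    L-unique = allPairs-++⁻ˡ L unique
    R-unique = AllPairs.tail (allPairs-++⁻ʳ L unique)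

    L<N : All (ℕ._< N) L
    L<N = All.zipWith (λ { (x<1+N , x≢N ∷ _) → ℕ.≤∧≢⇒< (ℕ.≤-pred x<1+N) x≢N })
      (All.++⁻ˡ L (proj₁ (proj₂ perm)) , allPairs-++⁻ L unique)

  |L|+|R|≡N : length L ℕ.+ length R ≡ N
  |L|+|R|≡N = ℕ.suc-injective (trans (sym (ℕ.+-suc (length L) (length R))) (trans (sym (List.length-++ L)) (proj₁ perm)))

  -- For x in R the entries of L and 0, …, x are distinct.
  right-isPermutation : IsPermutation (length R) R
  right-isPermutation = refl , All.tabulate bound , R-unique
    where
    bound : ∀ {x} → x ∈ R → x ℕ.< length R
    bound {x} x∈R = ℕ.+-cancelˡ-≤ (length L) (suc x) (length R) (begin
      length L ℕ.+ suc x                      ≡⟨ cong (length L ℕ.+_) (List.length-upTo (suc x)) ⟨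
      length L ℕ.+ length (upTo (suc x))      ≡⟨ List.length-++ L ⟨
      length (L ++ upTo (suc x))              ≤⟨ unique-bounded⇒length≤ all-unique all-bounded ⟩
      N                                       ≡⟨ |L|+|R|≡N ⟨
      length L ℕ.+ length R                   ∎)
      where
      open ℕ.≤-Reasoning
      x<N : x ℕ.< N
      x<N with All.++⁻ʳ L (proj₁ (proj₂ perm)) | allPairs-++⁻ʳ L unique
      ... | _ ∷ R<1+N | N≢R ∷ _ = ℕ.≤∧≢⇒< (ℕ.≤-pred (All.lookup R<1+N x∈R)) (All.lookup N≢R x∈R ∘ sym)
      all-unique : Unique (L ++ upTo (suc x))
      all-unique = Unique.++⁺ L-unique (Unique.upTo⁺ (suc x)) λ (y∈L , y∈upTo) →
        ℕ.<⇒≱ (All.lookup (All.lookup R<L y∈L) x∈R) (ℕ.≤-pred (∈-upTo⁻ y∈upTo))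
      all-bounded : All (ℕ._< N) (L ++ upTo (suc x))
      all-bounded = All.++⁺ L<N (All.tabulate λ y∈upTo → ℕ.≤-<-trans (ℕ.≤-pred (∈-upTo⁻ y∈upTo)) x<N)

  -- Each letter x of `L` exceeds all the distinct letters of `R`, so x is at least the length of
  -- `R` by the pigeonhole principle, and subtracting this length loses nothing.
  left-isPermutation : ∃[ L′ ] map (length R ℕ.+_) L′ ≡ L × IsPermutation (length L) L′
  left-isPermutation = L′ , shifted , List.length-map _ L , L′-bounded ,
    Unique.map⁻ (subst Unique (sym shifted) L-unique)
    where
    L′ = map (ℕ._∸ length R) L
    |R|≤L : All (length R ℕ.≤_) L
    |R|≤L = All.map (unique-bounded⇒length≤ R-unique) R<L
    unshift : ∀ {xs} → All (length R ℕ.≤_) xs → map (length R ℕ.+_) (map (ℕ._∸ length R) xs) ≡ xs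
    unshift []           = refl
    unshift (r≤x ∷ r≤xs) = cong₂ _∷_ (ℕ.m+[n∸m]≡n r≤x) (unshift r≤xs)
    shifted = unshift |R|≤L
    L′-bounded : All (ℕ._< length L) L′
    L′-bounded = All.map⁺ (All.zipWith (λ {x} (r≤x , x<N) → ℕ.+-cancelˡ-< (length R) _ _ (begin-strict
      length R ℕ.+ (x ℕ.∸ length R)   ≡⟨ ℕ.m+[n∸m]≡n r≤x ⟩
      x                               <⟨ x<N ⟩
      N                               ≡⟨ |L|+|R|≡N ⟨
      length L ℕ.+ length R           ≡⟨ ℕ.+-comm (length L) (length R) ⟩
      length R ℕ.+ length L           ∎)) (|R|≤L , L<N))
      where open ℕ.≤-Reasoning

permutation-surjective : ∀ {xs} → IsPermutation n xs → Avoids132 xs → ∃[ t ] size t ≡ n × permutation t ≡ xs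
permutation-surjective {n} = bounded n n ℕ.≤-refl
  where
  -- `b` is the measure of the recursion: the blocks are not subterms of the permutation, but both
  -- have length at most `N`.
  bounded : ∀ b n → n ℕ.≤ b → ∀ {xs} → IsPermutation n xs → Avoids132 xs → ∃[ t ] size t ≡ n × permutation t ≡ xs
  bounded b       zero    _         {[]} _    _      = leaf , refl , refl
  bounded (suc b) (suc N) (s≤s N≤b) perm avoids
    with L , R , refl ← ∈-∃++ (max∈permutation perm)
    with R<L ← avoids132-max L avoids (proj₂ (proj₂ perm))
      (All.zipWith (λ (x<1+N , N≢x) → ℕ.≤∧≢⇒< (ℕ.≤-pred x<1+N) (N≢x ∘ sym))
        (All.tail (All.++⁻ʳ L (proj₁ (proj₂ perm))) , AllPairs.head (allPairs-++⁻ʳ L (proj₂ (proj₂ perm)))))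
    with |L|+|R|≡N ← |L|+|R|≡N {N} {L} {R} perm R<L
    with L′ , refl , L′-perm ← left-isPermutation {N} {L} {R} perm R<L
    with l , |l| , l-perm ← bounded b _ (ℕ.≤-trans (ℕ.m+n≤o⇒m≤o _ (ℕ.≤-reflexive |L|+|R|≡N)) N≤b) L′-perm
           (avoids132-shift⁻ (length R) (avoids132-++⁻ˡ L avoids))
    with r , |r| , refl ← bounded b (length R) (ℕ.≤-trans (ℕ.m+n≤o⇒n≤o (length L) (ℕ.≤-reflexive |L|+|R|≡N)) N≤b)
           (right-isPermutation {N} {L} {R} perm R<L) (proj₂ (avoids132-++⁻ʳ L avoids))
    = node l r , cong suc |node|≡N , cong₂ (λ xs z → xs ++ z ∷ permutation r)
        (cong₂ (λ s → map (s ℕ.+_)) |r| l-perm) |node|≡N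
    where
    |node|≡N = trans (cong₂ ℕ._+_ |l| |r|) |L|+|R|≡N

-- One-line notation as lists of numbers.

word : Vec (Fin n) m → List ℕ
word w = toList (values w)

word-injective : (w w′ : Vec (Fin n) m) → word w ≡ word w′ → w ≡ w′
word-injective []      []        _  = refl
word-injective (i ∷ w) (i′ ∷ w′) eq with p , q ← List.∷-injective eq =
  cong₂ _∷_ (Fin.toℕ-injective p) (word-injective w w′ q)

word-bounded : (w : Vec (Fin n) m) → All (ℕ._< n) (word w)
word-bounded []      = []
word-bounded (i ∷ w) = Fin.toℕ<n i ∷ word-bounded w

word-length : (w : Vec (Fin n) m) → length (word w) ≡ m
word-length []      = refl
word-length (i ∷ w) = cong suc (word-length w)

word-unique : (w : Vec (Fin n) m) → Vec.Unique w ⇔ Unique (word w)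
word-unique w = mk⇔ (⇒ w) (⇐ w)
  where
  All⇒ : ∀ {i : Fin n} (w : Vec (Fin n) m) → VecAll.All (i ≢_) w → All (toℕ i ≢_) (word w)
  All⇒ []      _                  = []
  All⇒ (j ∷ w) (i≢j VecAll.∷ i≢w) = i≢j ∘ Fin.toℕ-injective ∷ All⇒ w i≢w
  All⇐ : ∀ {i : Fin n} (w : Vec (Fin n) m) → All (toℕ i ≢_) (word w) → VecAll.All (i ≢_) w
  All⇐ []      _           = VecAll.[]
  All⇐ (j ∷ w) (i≢j ∷ i≢w) = (i≢j ∘ cong toℕ) VecAll.∷ All⇐ w i≢w
  ⇒ : (w : Vec (Fin n) m) → Vec.Unique w → Unique (word w)
  ⇒ []      _                     = []
  ⇒ (i ∷ w) (i≢w VecAllPairs.∷ u) = All⇒ w i≢w ∷ ⇒ w u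
  ⇐ : (w : Vec (Fin n) m) → Unique (word w) → Vec.Unique w
  ⇐ []      _         = VecAllPairs.[]
  ⇐ (i ∷ w) (i≢w ∷ u) = All⇐ w i≢w VecAllPairs.∷ ⇐ w u

word-surjective : ∀ {xs} → length xs ≡ m → All (ℕ._< n) xs → ∃[ w ] word {n} {m} w ≡ xs
word-surjective {xs = []}     refl []            = [] , refl
word-surjective {xs = x ∷ xs} refl (x<n ∷ xs<n) with w , eq ← word-surjective refl xs<n =
  fromℕ< x<n ∷ w , cong₂ _∷_ (Fin.toℕ-fromℕ< x<n) eq

all⇔lookup : ∀ {P : ℕ → Set} (ys : Vec ℕ m) → All P (toList ys) ⇔ (∀ i → P (lookup ys i))
all⇔lookup ys = mk⇔ (⇒ ys) (⇐ ys)
  where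
  ⇒ : ∀ {P : ℕ → Set} (ys : Vec ℕ m) → All P (toList ys) → ∀ i → P (lookup ys i)
  ⇒ (y ∷ ys) (Py ∷ _)   zero    = Py
  ⇒ (y ∷ ys) (_ ∷ Pys)  (suc i) = ⇒ ys Pys i
  ⇐ : ∀ {P : ℕ → Set} (ys : Vec ℕ m) → (∀ i → P (lookup ys i)) → All P (toList ys)
  ⇐ []       _ = []
  ⇐ (y ∷ ys) P = P zero ∷ ⇐ ys (P ∘ suc)

allPairs⇔lookup : ∀ {Q : ℕ → ℕ → Set} (ys : Vec ℕ m) →
  AllPairs Q (toList ys) ⇔ (∀ i j → i Fin.< j → Q (lookup ys i) (lookup ys j))
allPairs⇔lookup {Q = Q} ys = mk⇔ (⇒ ys) (⇐ ys)
  where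
  ⇒ : (ys : Vec ℕ m) → AllPairs Q (toList ys) → ∀ i j → i Fin.< j → Q (lookup ys i) (lookup ys j)
  ⇒ (y ∷ ys) (Qy ∷ _) zero    (suc j) _         = to (all⇔lookup ys) Qy j
  ⇒ (y ∷ ys) (_ ∷ Q)  (suc i) (suc j) (s≤s i<j) = ⇒ ys Q i j i<j
  ⇐ : (ys : Vec ℕ m) → (∀ i j → i Fin.< j → Q (lookup ys i) (lookup ys j)) → AllPairs Q (toList ys)
  ⇐ []       _ = []
  ⇐ (y ∷ ys) Q = from (all⇔lookup ys) (λ j → Q zero (suc j) (s≤s z≤n)) ∷ ⇐ ys (λ i j i<j → Q (suc i) (suc j) (s≤s i<j))

avoids132⇔lookup : (ys : Vec ℕ m) → Avoids132 (toList ys) ⇔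
  (∀ i j k → i Fin.< j → j Fin.< k → ¬ (lookup ys i ℕ.< lookup ys k × lookup ys k ℕ.< lookup ys j))
avoids132⇔lookup ys = mk⇔ (⇒ ys) (⇐ ys)
  where
  No132 : Vec ℕ m → Set
  No132 ys = ∀ i j k → i Fin.< j → j Fin.< k → ¬ (lookup ys i ℕ.< lookup ys k × lookup ys k ℕ.< lookup ys j)
  ⇒ : (ys : Vec ℕ m) → Avoids132 (toList ys) → No132 ys
  ⇒ (y ∷ ys) (p , _) zero    (suc j) (suc k) _         (s≤s j<k) = to (allPairs⇔lookup ys) p j k j<k
  ⇒ (y ∷ ys) (_ , q) (suc i) (suc j) (suc k) (s≤s i<j) (s≤s j<k) = ⇒ ys q i j k i<j j<k
  ⇐ : (ys : Vec ℕ m) → No132 ys → Avoids132 (toList ys)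
  ⇐ []       _     = tt
  ⇐ (y ∷ ys) no132 =
    from (allPairs⇔lookup ys) (λ j k j<k → no132 zero (suc j) (suc k) (s≤s z≤n) (s≤s j<k)) ,
    ⇐ ys (λ i j k i<j j<k → no132 (suc i) (suc j) (suc k) (s≤s i<j) (s≤s j<k))

no-132⇔avoids132 : (π : Vec (Fin n) n) → occurrences 1-3-2 π ≡ 0 ⇔ Avoids132 (word π)
no-132⇔avoids132 π = mk⇔
  (λ none → from (avoids132⇔lookup (values π)) λ i j k i<j j<k (πi<πk , πk<πj) →
    to (HasCard-0⇔∅ (IsOccurrence-count π 1-3-2)) none (i ∷ j ∷ k ∷ [])
      (from (occurrence⇔132 π i j k) (i<j , j<k , πi<πk , πk<πj)))
  (λ avoids → from (HasCard-0⇔∅ (IsOccurrence-count π 1-3-2)) λ where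
    (i ∷ j ∷ k ∷ []) occ → let i<j , j<k , πi<πk , πk<πj = to (occurrence⇔132 π i j k) occ in
      to (avoids132⇔lookup (values π)) avoids i j k i<j j<k (πi<πk , πk<πj))

-- Equality of the two enumerations.

trees-of-height≤-unique : ∀ h → Unique (trees-of-height≤ h)
trees-of-height≤-unique h = All.tabulate (λ { t∈ refl → leaf∉nodes h t∈ }) ∷ nodes-unique h
  where
  leaf∉nodes : ∀ h → leaf ∉ nodes-of-height≤ h
  leaf∉nodes (suc h) leaf∈
    with _ , _ , _ , _ , () ← ∈-cartesianProductWith⁻ node (trees-of-height≤ h) (trees-of-height≤ h) leaf∈
  nodes-unique : ∀ h → Unique (nodes-of-height≤ h)
  nodes-unique zero    = []
  nodes-unique (suc h) = Unique.cartesianProductWith⁺ node (λ { refl → refl , refl })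
    (trees-of-height≤-unique h) (trees-of-height≤-unique h)

size≤⇒∈trees-of-height≤ : ∀ t {h} → size t ℕ.≤ h → t ∈ trees-of-height≤ h
size≤⇒∈trees-of-height≤ leaf       _               = here refl
size≤⇒∈trees-of-height≤ (node l r) {suc h} (s≤s l+r≤h) = there (∈-cartesianProductWith⁺ node
  (size≤⇒∈trees-of-height≤ l (ℕ.m+n≤o⇒m≤o (size l) l+r≤h))
  (size≤⇒∈trees-of-height≤ r (ℕ.m+n≤o⇒n≤o (size l) l+r≤h)))

-- The common ground of the comparison: the counted vectors map onto it injectively by `word`, the
-- trees by `permutation`.
Statistics : ℕ → ℕ → ℕ → List ℕ → Set
Statistics j r n xs = IsPermutation n xs × Avoids132 xs × 21-3-count j xs ≡ r

counted⇔statistics : ∀ j r (π : Vec (Fin n) n) → Counted (21-3-⋯- (suc (suc j))) r π ⇔ Statistics j r n (word π)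
counted⇔statistics j r π = mk⇔
  (λ (unique , no132 , count) → (word-length π , word-bounded π , to (word-unique π) unique) ,
     to (no-132⇔avoids132 π) no132 , trans (sym (occurrences-21-3 π j)) count)
  (λ ((_ , _ , unique) , avoids , count) → from (word-unique π) unique ,
     from (no-132⇔avoids132 π) avoids , trans (occurrences-21-3 π j) count)

words-statistics : ∀ j r n → Statistics j r n HasCard f (21-3-⋯- (suc (suc j))) r n
words-statistics j r n = HasCard-⇔
  (HasCard-Image word (λ {w} {w′} → word-injective w w′)
    (HasCard-filter (counted? (21-3-⋯- (suc (suc j))) r) (words-unique n n) (λ π _ → words-complete π)))
  λ xs → mk⇔ (λ { (π , counted , refl) → to (counted⇔statistics j r π) counted }) (backward xs)
  where
  backward : ∀ xs → Statistics j r n xs → Image word (Counted {n = n} (21-3-⋯- (suc (suc j))) r) xs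
  backward xs s@((len , bounded , _) , _) = π , from (counted⇔statistics j r π) (subst (Statistics j r n) (sym eq) s) , eq
    where
    π  = proj₁ (word-surjective len bounded)
    eq = proj₂ (word-surjective len bounded)

trees-statistics : ∀ j r n → Statistics j r n HasCard
  length (filter (λ t → (size t ℕ.≟ n) ×-dec (weight j 0 t ℕ.≟ r)) (trees-of-height≤ n))
trees-statistics j r n = HasCard-⇔
  (HasCard-Image permutation (λ {t} {t′} → permutation-injective t t′)
    (HasCard-filter (λ t → (size t ℕ.≟ n) ×-dec (weight j 0 t ℕ.≟ r)) (trees-of-height≤-unique n)
      (λ t (|t|≡n , _) → size≤⇒∈trees-of-height≤ t (ℕ.≤-reflexive |t|≡n))))
  λ xs → mk⇔
    (λ { (t , (refl , refl) , refl) → permutation-isPermutation t , permutation-avoids132 t , permutation-21-3-count j t })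
    (λ (perm , avoids , count) → let t , |t|≡n , eq = permutation-surjective perm avoids in
      t , (|t|≡n , trans (sym (permutation-21-3-count j t)) (trans (cong (21-3-count j) eq) count)) , eq)

f-counts-trees : ∀ j r n → f (21-3-⋯- (suc (suc j))) r n ≡
  length (filter (λ t → (size t ℕ.≟ n) ×-dec (weight j 0 t ℕ.≟ r)) (trees-of-height≤ n))
f-counts-trees j r n = HasCard-unique (words-statistics j r n) (trees-statistics j r n)

-- Coefficients over ℚ

open import Data.Integer.Base using (+_)
import Data.Integer.Properties as ℤ
open import Data.Rational.Base as ℚ using (ℚ; 0ℚ; 1ℚ; ½; _/_)
import Data.Rational.Properties as ℚ
import Data.Rational.Unnormalised.Base as ℚᵘ
open import Defs

private
  module ℚ[x] = PowerSeries ℚ.+-*-commutativeRing (λ _ → ⊤) (λ _ _ → tt)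

ℚ⟦x⟧ : CommutativeRing _ _
ℚ⟦x⟧ = ℚ[x].power-series

private
  module S = CommutativeRing ℚ⟦x⟧

open S using () renaming (_≈_ to _≃_; _*_ to _∙_; 1# to 1ₛ)
open ℚ[x] using (X)
open Exp S.commutativeSemiring using (^-homo-*; ^-distrib-*) renaming (_^_ to _^ₛ_; ^-congˡ to ^ₛ-congˡ)
open ReducedChebyshev ℚ⟦x⟧ X using (u)
open Quotients ℚ⟦x⟧

⊛≗∙ : ∀ a b → a ⊛ b ≗ a ∙ b
⊛≗∙ a b zero    = ℚ.+-identityʳ _
⊛≗∙ a b (suc n) = ≡.cong (a 0 ℚ.* b (suc n) ℚ.+_) (⊛≗∙ (λ i → a (suc i)) b n)

constant≗const : ∀ q → constant q ≗ ℚ[x].const q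
constant≗const q zero    = ≡.refl
constant≗const q (suc n) = ≡.refl

shift≃^∙ : ∀ m a → shift m a ≃ X ^ₛ m ∙ a
shift≃^∙ zero    a n       _ = ≡.sym (S.*-identityˡ a n tt)
shift≃^∙ (suc m) a zero    _ = ≡.sym (≡.trans (S.*-assoc X (X ^ₛ m) a 0 tt) (ℚ[x].X-⊛ (X ^ₛ m ∙ a) 0))
shift≃^∙ (suc m) a (suc n) _ = ≡.trans (shift≃^∙ m a n tt)
  (≡.sym (≡.trans (S.*-assoc X (X ^ₛ m) a (suc n) tt) (ℚ[x].X-⊛ (X ^ₛ m ∙ a) (suc n))))

X-cancel : ∀ {a b} → X ∙ a ≃ X ∙ b → a ≃ b
X-cancel {a} {b} eq n _ = ≡.trans (≡.sym (ℚ[x].X-⊛ a (suc n))) (≡.trans (eq (suc n) tt) (ℚ[x].X-⊛ b (suc n)))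

n·1≡n/1 : ∀ n → Mult._×_ ℚ.+-0-monoid n 1ℚ ≡ + n / 1
n·1≡n/1 zero    = ≡.refl
n·1≡n/1 (suc n) = ≡.trans (≡.cong (1ℚ ℚ.+_) (n·1≡n/1 n)) (≡.sym (ℚ.toℚᵘ-injective (begin
  ℚ.toℚᵘ (+ suc n / 1)                        ≈⟨ ℚ.toℚᵘ-fromℚᵘ (ℚᵘ.mkℚᵘ (+ suc n) 0) ⟩
  ℚᵘ.mkℚᵘ (+ suc n) 0                         ≈⟨ ℚᵘ.*≡* (≡.cong (ℤ._* + 1) numerator) ⟩
  ℚ.toℚᵘ 1ℚ ℚᵘ.+ ℚᵘ.mkℚᵘ (+ n) 0              ≈⟨ ℚᵘ.+-congʳ (ℚ.toℚᵘ 1ℚ) (ℚ.toℚᵘ-fromℚᵘ (ℚᵘ.mkℚᵘ (+ n) 0)) ⟨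
  ℚ.toℚᵘ 1ℚ ℚᵘ.+ ℚ.toℚᵘ (+ n / 1)             ≈⟨ ℚ.toℚᵘ-homo-+ 1ℚ (+ n / 1) ⟨
  ℚ.toℚᵘ (1ℚ ℚ.+ + n / 1)                     ∎)))
  where
  import Data.Rational.Unnormalised.Properties as ℚᵘ
  import Data.Integer.Base as ℤ
  open SetoidReasoning ℚᵘ.≃-setoid
  numerator : + suc n ≡ + 1 ℤ.* + 1 ℤ.+ + n ℤ.* + 1
  numerator = ≡.cong (λ i → + 1 ℤ.+ i) (≡.sym (ℤ.*-identityʳ (+ n)))

module _ (j : ℕ) where

  open GeneratingFunctions ℚ.+-*-commutativeRing j using (distribution; distribution-zero; distribution-closed-form; distribution-count; has-statistics?)

  F≃distribution : ∀ r → r ≤ j → F (21-3-⋯- (suc (suc j))) r ≃ distribution r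
  F≃distribution r r≤j n _ = ≡.trans (≡.cong (λ i → + i / 1) (f-counts-trees j r n))
    (≡.sym (≡.trans (distribution-count n r r≤j) (n·1≡n/1 (length (filter (has-statistics? n r) (trees-of-height≤ n))))))

  F-zero : u (suc (suc j)) ∙ F (21-3-⋯- (suc (suc j))) 0 ≃ u (suc j)
  F-zero = S.trans (S.*-congˡ {u (suc (suc j))} (F≃distribution 0 z≤n)) distribution-zero

  F-suc : ∀ r → suc r ≤ j → u (suc (suc j)) ^ₛ suc (suc r) ∙ F (21-3-⋯- (suc (suc j))) (suc r) ≃ X ^ₛ r ∙ u (suc j) ^ₛ r ∙ X ^ₛ suc (suc j)
  F-suc r r<j = S.trans (S.*-congˡ {u (suc (suc j)) ^ₛ suc (suc r)} (F≃distribution (suc r) r<j)) (distribution-closed-form r r<j)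

-- The generating functions supply the inverses: u_(j+2) times the series for r = 0 equals u_(j+1),
-- which is invertible by induction.
u-invertible : ∀ i → ∃[ v ] u i ∙ v ≃ 1ₛ
u-invertible 0             = 1ₛ , S.*-identityˡ 1ₛ
u-invertible 1             = 1ₛ , S.*-identityˡ 1ₛ
u-invertible (suc (suc j)) with v , u*v≃1 ← u-invertible (suc j) =
  F (21-3-⋯- (suc (suc j))) 0 ∙ v ,
  S.trans (S.sym (S.*-assoc (u (suc (suc j))) (F (21-3-⋯- (suc (suc j))) 0) v))
    (S.trans (S.*-congʳ {v} (F-zero j)) u*v≃1)

^-invertible : ∀ n {a b} → a ∙ b ≃ 1ₛ → a ^ₛ n ∙ b ^ₛ n ≃ 1ₛ
^-invertible n {a} {b} ab≃1 = S.trans (S.sym (^-distrib-* a b n)) (S.trans (^ₛ-congˡ n ab≃1) (1^n≃1 n))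
  where
  1^n≃1 : ∀ n → 1ₛ ^ₛ n ≃ 1ₛ
  1^n≃1 zero    = S.refl {1ₛ}
  1^n≃1 (suc n) = S.trans (S.*-identityˡ (1ₛ ^ₛ n)) (1^n≃1 n)

-- Rationality

∙-isPolynomial : ∀ {a b} → IsPolynomial a → IsPolynomial b → IsPolynomial (a ∙ b)
∙-isPolynomial {a} {b} (d , a>d≡0) (e , b>e≡0) = d ℕ.+ e , vanishes d a a>d≡0
  where
  b-vanishes : ∀ q n → e ℕ.< n → q ℚ.* b n ≡ 0ℚ
  b-vanishes q n e<n = ≡.trans (≡.cong (q ℚ.*_) (b>e≡0 n e<n)) (ℚ.*-zeroʳ q)
  vanishes : ∀ d a → (∀ n → d ℕ.< n → a n ≡ 0ℚ) → ∀ n → d ℕ.+ e ℕ.< n → (a ∙ b) n ≡ 0ℚ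
  vanishes zero    a a>0≡0 (suc n) e<n = ≡.cong₂ ℚ._+_ (b-vanishes (a 0) (suc n) e<n)
    (≡.trans (ℚ[x].⊛-cong-≗ (λ i → a>0≡0 (suc i) (s≤s z≤n)) (λ i → ≡.refl {x = b i}) n) (ℚ[x].⊛-zeroˡ b n))
  vanishes (suc d) a a>d≡0 (suc n) (s≤s d+e<n) = ≡.cong₂ ℚ._+_
    (b-vanishes (a 0) (suc n) (ℕ.m≤n⇒m≤1+n (ℕ.≤-<-trans (ℕ.m≤n+m e d) d+e<n)))
    (vanishes d (λ i → a (suc i)) (λ i d<i → a>d≡0 (suc i) (s≤s d<i)) n d+e<n)

1-isPolynomial : IsPolynomial 1ₛ
1-isPolynomial = 0 , λ { (suc n) _ → ≡.refl }

X-isPolynomial : IsPolynomial X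
X-isPolynomial = 1 , λ { (suc (suc n)) _ → ≡.refl ; (suc zero) (s≤s ()) }

^-isPolynomial : ∀ {a} n → IsPolynomial a → IsPolynomial (a ^ₛ n)
^-isPolynomial zero    _ = 1-isPolynomial
^-isPolynomial (suc n) p = ∙-isPolynomial p (^-isPolynomial n p)

u-isPolynomial : ∀ i → IsPolynomial (u i)
u-isPolynomial 0             = 1-isPolynomial
u-isPolynomial 1             = 1-isPolynomial
u-isPolynomial (suc (suc i))
  with d , u>d≡0 ← u-isPolynomial (suc i) | e , Xu>e≡0 ← ∙-isPolynomial X-isPolynomial (u-isPolynomial i) =
  d ℕ.+ e , λ n d+e<n → ≡.cong₂ (λ x y → x ℚ.- y)
    (u>d≡0 n (ℕ.≤-<-trans (ℕ.m≤m+n d e) d+e<n)) (Xu>e≡0 n (ℕ.≤-<-trans (ℕ.m≤n+m e d) d+e<n))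

isRational : ∀ {p q a} → IsPolynomial p → IsPolynomial q → (∃[ v ] q ∙ v ≃ 1ₛ) → q ∙ a ≃ p → IsRational a
isRational {p} {q} {a} p-poly q-poly (v , qv≃1) qa≃p = p , q , p-poly , q-poly , q≢0 ,
  λ n → ≡.trans (⊛≗∙ q a n) (qa≃p n tt)
  where
  q≢0 : ¬ (q ≗ constant 0ℚ)
  q≢0 q≡0 with () ← ≡.trans (≡.sym (qv≃1 0 tt)) (≡.trans (≡.cong (ℚ._* v 0) (q≡0 0)) (ℚ.*-zeroˡ (v 0)))

F-isRational : ∀ j r → r ≤ j → IsRational (F (21-3-⋯- (suc (suc j))) r)
F-isRational j zero    _   = isRational (u-isPolynomial (suc j)) (u-isPolynomial (suc (suc j))) (u-invertible (suc (suc j))) (F-zero j)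
F-isRational j (suc r) r<j = isRational
  (∙-isPolynomial (∙-isPolynomial (^-isPolynomial r X-isPolynomial) (^-isPolynomial r (u-isPolynomial (suc j))))
    (^-isPolynomial (suc (suc j)) X-isPolynomial))
  (^-isPolynomial (suc (suc r)) (u-isPolynomial (suc (suc j))))
  (_ , ^-invertible (suc (suc r)) (proj₂ (u-invertible (suc (suc j)))))
  (F-suc j r r<j)

-- Laurent series in √x

sq : Series → Series
sq = square-argument

sq-cong : ∀ {a b} → a ≃ b → sq a ≃ sq b
sq-cong a≃b zero          _ = a≃b 0 tt
sq-cong a≃b (suc zero)    _ = ≡.refl
sq-cong a≃b (suc (suc n)) _ = sq-cong (λ i _ → a≃b (suc i) tt) n tt

sq-+ : ∀ a b → sq (λ n → a n ℚ.+ b n) ≃ sq a S.+ sq b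
sq-+ a b zero          _ = ≡.refl
sq-+ a b (suc zero)    _ = ≡.refl
sq-+ a b (suc (suc n)) _ = sq-+ (λ i → a (suc i)) (λ i → b (suc i)) n tt

sq-neg : ∀ a → sq (S.- a) ≃ S.- sq a
sq-neg a zero          _ = ≡.refl
sq-neg a (suc zero)    _ = ≡.refl
sq-neg a (suc (suc n)) _ = sq-neg (λ i → a (suc i)) n tt

sq-scale : ∀ q a → sq (λ n → q ℚ.* a n) ≃ (λ n → q ℚ.* sq a n)
sq-scale q a zero          _ = ≡.refl
sq-scale q a (suc zero)    _ = ≡.sym (ℚ.*-zeroʳ q)
sq-scale q a (suc (suc n)) _ = sq-scale q (λ i → a (suc i)) n tt

sq-∙ : ∀ a b → sq (a ∙ b) ≃ sq a ∙ sq b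
sq-∙ a b zero          _ = ≡.refl
sq-∙ a b (suc zero)    _ = ≡.sym (≡.cong₂ ℚ._+_ (ℚ.*-zeroʳ (a 0)) (ℚ.*-zeroˡ (b 0)))
sq-∙ a b (suc (suc n)) _ = begin
  sq (λ i → a 0 ℚ.* b (suc i) ℚ.+ ((λ i → a (suc i)) ∙ b) i) n
    ≡⟨ sq-+ (λ i → a 0 ℚ.* b (suc i)) ((λ i → a (suc i)) ∙ b) n tt ⟩
  sq (λ i → a 0 ℚ.* b (suc i)) n ℚ.+ sq ((λ i → a (suc i)) ∙ b) n
    ≡⟨ ≡.cong₂ ℚ._+_ (sq-scale (a 0) (λ i → b (suc i)) n tt) (sq-∙ (λ i → a (suc i)) b n tt) ⟩
  a 0 ℚ.* sq b (suc (suc n)) ℚ.+ (sq (λ i → a (suc i)) ∙ sq b) n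
    ≡⟨ ≡.cong (a 0 ℚ.* sq b (suc (suc n)) ℚ.+_) (≡.trans (≡.cong (ℚ._+ rest) (ℚ.*-zeroˡ (sq b (suc n)))) (ℚ.+-identityˡ rest)) ⟨
  (sq a ∙ sq b) (suc (suc n)) ∎
  where
  open ≡.≡-Reasoning
  rest = (sq (λ i → a (suc i)) ∙ sq b) n

sq-1 : sq 1ₛ ≃ 1ₛ
sq-1 zero          _ = ≡.refl
sq-1 (suc zero)    _ = ≡.refl
sq-1 (suc (suc n)) _ = zeros n
  where
  zeros : ∀ n → sq (λ _ → 0ℚ) n ≡ 0ℚ
  zeros zero          = ≡.refl
  zeros (suc zero)    = ≡.refl
  zeros (suc (suc n)) = zeros n

sq-X : sq X ≃ X ∙ X
sq-X n _ = ≡.trans (sq-X≡ n) (≡.sym (ℚ[x].X-⊛ X n))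
  where
  sq-X≡ : ∀ n → sq X n ≡ ℚ[x].shift1 X n
  sq-X≡ zero          = ≡.refl
  sq-X≡ (suc zero)    = ≡.refl
  sq-X≡ (suc (suc n)) = sq-1 n tt

sq-^ : ∀ a n → sq (a ^ₛ n) ≃ sq a ^ₛ n
sq-^ a zero    = sq-1
sq-^ a (suc n) = S.trans (sq-∙ a (a ^ₛ n)) (S.*-congˡ {sq a} (sq-^ a n))

sq-u : ∀ i → sq (u (suc (suc i))) ≃ sq (u (suc i)) S.- X ∙ X ∙ sq (u i)
sq-u i = begin
  sq (u (suc i) S.- X ∙ u i)               ≈⟨ sq-+ (u (suc i)) (S.- (X ∙ u i)) ⟩
  sq (u (suc i)) S.+ sq (S.- (X ∙ u i))    ≈⟨ S.+-congˡ {sq (u (suc i))} (S.trans (sq-neg (X ∙ u i)) (S.-‿cong (S.trans (sq-∙ X (u i)) (S.*-congʳ {sq (u i)} sq-X)))) ⟩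
  sq (u (suc i)) S.- X ∙ X ∙ sq (u i)      ∎
  where open SetoidReasoning S.setoid

open Laurent

-- L equals (√x)⁻ᵐ a(√x), whatever the order of the pole that L records.
infix 4 _∼s^-_·_
record _∼s^-_·_ (L : Laurent) (m : ℕ) (a : Series) : Set where
  constructor clear
  field cleared : X ^ₛ m ∙ series L ≃ X ^ₛ order L ∙ a

open _∼s^-_·_

^ₛ-+ : ∀ m n a → X ^ₛ (m ℕ.+ n) ∙ a ≃ X ^ₛ m ∙ X ^ₛ n ∙ a
^ₛ-+ m n a = S.*-congʳ {a} (^-homo-* X m n)

∼-* : ∀ L M {m n a b} → L ∼s^- m · a → M ∼s^- n · b → L * M ∼s^- (m ℕ.+ n) · a ∙ b
∼-* L M {m} {n} {a} {b} (clear p) (clear q) = clear (begin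
  X ^ₛ (m ℕ.+ n) ∙ (series L ⊛ series M)           ≈⟨ S.*-cong (^-homo-* X m n) (λ i _ → ⊛≗∙ (series L) (series M) i) ⟩
  (X ^ₛ m ∙ X ^ₛ n) ∙ (series L ∙ series M)        ≈⟨ *-interchange p q ⟩
  (X ^ₛ order L ∙ X ^ₛ order M) ∙ (a ∙ b)          ≈⟨ ^ₛ-+ (order L) (order M) (a ∙ b) ⟨
  X ^ₛ (order L ℕ.+ order M) ∙ (a ∙ b)             ∎)
  where open SetoidReasoning S.setoid

∼-+ : ∀ L M {m a b} → L ∼s^- m · a → M ∼s^- m · b → RawRing._+_ laurent L M ∼s^- m · (a S.+ b)
∼-+ L M {m} {a} {b} (clear p) (clear q) = clear (begin
  X ^ₛ m ∙ (λ i → shift (order M) (series L) i ℚ.+ shift (order L) (series M) i)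
    ≈⟨ S.*-congˡ {X ^ₛ m} (S.+-cong (shift≃^∙ (order M) (series L)) (shift≃^∙ (order L) (series M))) ⟩
  X ^ₛ m ∙ (X ^ₛ order M ∙ series L S.+ X ^ₛ order L ∙ series M)   ≈⟨ common-denominator p q ⟩
  X ^ₛ order L ∙ X ^ₛ order M ∙ (a S.+ b)                          ≈⟨ ^ₛ-+ (order L) (order M) (a S.+ b) ⟨
  X ^ₛ (order L ℕ.+ order M) ∙ (a S.+ b)                           ∎)
  where open SetoidReasoning S.setoid

∼-neg : ∀ L {m a} → L ∼s^- m · a → RawRing.-_ laurent L ∼s^- m · S.- a
∼-neg L {m} {a} (clear p) = clear (begin
  X ^ₛ m ∙ S.- series L          ≈⟨ -‿distribʳ-* (X ^ₛ m) (series L) ⟨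
  S.- (X ^ₛ m ∙ series L)        ≈⟨ S.-‿cong p ⟩
  S.- (X ^ₛ order L ∙ a)         ≈⟨ -‿distribʳ-* (X ^ₛ order L) a ⟩
  X ^ₛ order L ∙ S.- a           ∎)
  where
  open RingProperties S.ring using (-‿distribʳ-*)
  open SetoidReasoning S.setoid

∼-raise : ∀ L {m a} → L ∼s^- m · a → L ∼s^- suc m · X ∙ a
∼-raise L {m} {a} (clear p) = clear (begin
  X ∙ X ^ₛ m ∙ series L      ≈⟨ S.*-assoc X (X ^ₛ m) (series L) ⟩
  X ∙ (X ^ₛ m ∙ series L)    ≈⟨ S.*-congˡ {X} p ⟩
  X ∙ (X ^ₛ order L ∙ a)     ≈⟨ x∙yz≈y∙xz X (X ^ₛ order L) a ⟩
  X ^ₛ order L ∙ (X ∙ a)     ∎)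
  where
  open import Algebra.Properties.CommutativeSemigroup S.*-commutativeSemigroup using (x∙yz≈y∙xz)
  open SetoidReasoning S.setoid

-- Multiplication by `X` only shifts coefficients, hence can be cancelled. This absorbs the factor
-- `√x` in the denominator for r = 0.
∼-lower : ∀ L {m a} → L ∼s^- suc m · X ∙ a → L ∼s^- m · a
∼-lower L {m} {a} (clear p) = clear (X-cancel (begin
  X ∙ (X ^ₛ m ∙ series L)    ≈⟨ S.*-assoc X (X ^ₛ m) (series L) ⟨
  X ∙ X ^ₛ m ∙ series L      ≈⟨ p ⟩
  X ^ₛ order L ∙ (X ∙ a)     ≈⟨ x∙yz≈y∙xz (X ^ₛ order L) X a ⟩
  X ∙ (X ^ₛ order L ∙ a)     ∎))
  where
  open import Algebra.Properties.CommutativeSemigroup S.*-commutativeSemigroup using (x∙yz≈y∙xz)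
  open SetoidReasoning S.setoid

∼-cong : ∀ L {m a b} → a ≃ b → L ∼s^- m · a → L ∼s^- m · b
∼-cong L a≃b (clear p) = clear (S.trans p (S.*-congˡ {X ^ₛ order L} a≃b))

∼-s^- : ∀ m a → (s^- m · a) ∼s^- m · a
∼-s^- m a = clear (S.refl {X ^ₛ m ∙ a})

constant≃const : ∀ q → constant q ≃ ℚ[x].const q
constant≃const q n _ = constant≗const q n

∼-1 : 1# ∼s^- 0 · 1ₛ
∼-1 = ∼-cong 1# (constant≃const 1ℚ) (∼-s^- 0 (constant 1ℚ))

∼-√x : √x ∼s^- 0 · X
∼-√x = ∼-cong √x shift1≃X (∼-s^- 0 (shift 1 (constant 1ℚ)))
  where
  shift1≃X : shift 1 (constant 1ℚ) ≃ X
  shift1≃X zero    _ = ≡.refl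
  shift1≃X (suc n) _ = constant≗const 1ℚ n

∼-1/√x : RawRing._+_ laurent 1/2√x 1/2√x ∼s^- 1 · 1ₛ
∼-1/√x = ∼-cong (RawRing._+_ laurent 1/2√x 1/2√x) halves
  (∼-+ 1/2√x 1/2√x {1} {constant ½} {constant ½} (∼-s^- 1 (constant ½)) (∼-s^- 1 (constant ½)))
  where
  halves : constant ½ S.+ constant ½ ≃ 1ₛ
  halves zero    _ = ≡.refl
  halves (suc n) _ = ≡.refl

∼-^ : ∀ L {m a} n → L ∼s^- m · a → L ^ n ∼s^- (n ℕ.* m) · a ^ₛ n
∼-^ L zero    p = ∼-1
∼-^ L (suc n) p = ∼-* L (L ^ n) p (∼-^ L n p)

∼-U : ∀ i → U i 1/2√x ∼s^- i · sq (u i)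
∼-U 0             = ∼-cong 1# (S.sym sq-1) ∼-1
∼-U 1             = ∼-cong (RawRing._+_ laurent 1/2√x 1/2√x) (S.sym sq-1) ∼-1/√x
∼-U (suc (suc i)) = ∼-cong (U (suc (suc i)) 1/2√x) {suc (suc i)} rearrange
  (∼-+ (2t * U₁) (RawRing.-_ laurent U₀) {suc (suc i)} (∼-* 2t U₁ {1} {suc i} ∼-1/√x (∼-U (suc i)))
    -- Before the subtraction the pole order of `U₀` is raised from i to i + 2. The two factors `X`
    -- gained are the image of the x in the recurrence of `u`.
    (∼-neg U₀ {suc (suc i)} (∼-raise U₀ {suc i} (∼-raise U₀ {i} (∼-U i)))))
  where
  open SetoidReasoning S.setoid
  2t = RawRing._+_ laurent 1/2√x 1/2√x
  U₁ = U (suc i) 1/2√x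
  U₀ = U i 1/2√x
  rearrange : 1ₛ ∙ sq (u (suc i)) S.- X ∙ (X ∙ sq (u i)) ≃ sq (u (suc (suc i)))
  rearrange = begin
    1ₛ ∙ sq (u (suc i)) S.- X ∙ (X ∙ sq (u i))
      ≈⟨ S.+-cong (S.*-identityˡ (sq (u (suc i)))) (S.-‿cong (S.sym (S.*-assoc X X (sq (u i))))) ⟩
    sq (u (suc i)) S.- X ∙ X ∙ sq (u i)     ≈⟨ sq-u i ⟨
    sq (u (suc (suc i)))                    ∎

-- `e` is the excess of the recorded pole order of `Den` over that of `Num`. As `Den` is
-- (√x)^(-(m+e)) γ and γ has inverse `v`, its inverse is (√x)^(m+e) `v`, a series without pole, and
-- the quotient is (√x)^e β/γ.
∼-÷ : ∀ {a v β γ} Num Den m e → Num ∼s^- m · β → Den ∼s^- (m ℕ.+ e) · γ → γ ∙ v ≃ 1ₛ → γ ∙ sq a ≃ X ^ₛ e ∙ β → ⟦ a ⟧ ≈ Num ÷ Den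
∼-÷ {a} {v} {β} {γ} Num Den m e (clear Num∼) (clear Den∼) γv≃1 γa≃ = D , (λ n → Den∙D≃1 n tt) , (λ n → A≃Num∙D n tt)
  where
  open SetoidReasoning S.setoid
  D = s^- 0 · (X ^ₛ (m ℕ.+ e) ∙ v)

  Den∙D≃1 : shift 0 (series Den ⊛ series D) ≃ shift (order Den ℕ.+ 0) (constant 1ℚ)
  Den∙D≃1 = begin
    shift 0 (series Den ⊛ series D)            ≈⟨ (λ n _ → ⊛≗∙ (series Den) (series D) n) ⟩
    series Den ∙ (X ^ₛ (m ℕ.+ e) ∙ v)
      ≈⟨ cancel-unit {X ^ₛ (m ℕ.+ e) ∙ v} {series Den} {X ^ₛ order Den} {X ^ₛ (m ℕ.+ e)} {v} {γ} Den∼ γv≃1 (S.refl {X ^ₛ (m ℕ.+ e) ∙ v}) ⟩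
    X ^ₛ order Den                             ≈⟨ S.*-identityʳ (X ^ₛ order Den) ⟨
    X ^ₛ order Den ∙ 1ₛ                        ≈⟨ S.*-congˡ {X ^ₛ order Den} (constant≃const 1ℚ) ⟨
    X ^ₛ order Den ∙ constant 1ℚ               ≈⟨ shift≃^∙ (order Den) (constant 1ℚ) ⟨
    shift (order Den) (constant 1ℚ)            ≈⟨ (λ n _ → ≡.cong (λ o → shift o (constant 1ℚ) n) (ℕ.+-identityʳ (order Den))) ⟨
    shift (order Den ℕ.+ 0) (constant 1ℚ)      ∎

  A≃Num∙D : shift (order Num ℕ.+ 0) (sq a) ≃ shift 0 (series Num ⊛ series D)
  A≃Num∙D = begin
    shift (order Num ℕ.+ 0) (sq a)             ≈⟨ (λ n _ → ≡.cong (λ o → shift o (sq a) n) (ℕ.+-identityʳ (order Num))) ⟩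
    shift (order Num) (sq a)                   ≈⟨ shift≃^∙ (order Num) (sq a) ⟩
    X ^ₛ order Num ∙ sq a
      ≈⟨ quotient {sq a} {series Num} {X ^ₛ (m ℕ.+ e) ∙ v} {X ^ₛ order Num} {X ^ₛ m} {X ^ₛ e} {β} {γ} {v} Num∼ γv≃1 γa≃ (^ₛ-+ m e v) ⟩
    series Num ∙ (X ^ₛ (m ℕ.+ e) ∙ v)          ≈⟨ (λ n _ → ⊛≗∙ (series Num) (series D) n) ⟨
    shift 0 (series Num ⊛ series D)            ∎

sq-invertible : ∀ {a b} → a ∙ b ≃ 1ₛ → sq a ∙ sq b ≃ 1ₛ
sq-invertible {a} {b} ab≃1 = S.trans (S.sym (sq-∙ a b)) (S.trans (sq-cong ab≃1) sq-1)

module _ (j : ℕ) where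

  private
    û = sq (u (suc (suc j)))
    ŵ = sq (u (suc j))
    v = proj₁ (u-invertible (suc (suc j)))

    ûv̂≃1 : û ∙ sq v ≃ 1ₛ
    ûv̂≃1 = sq-invertible (proj₂ (u-invertible (suc (suc j))))

  F-zero-laurent : ⟦ F (21-3-⋯- (suc (suc j))) 0 ⟧ ≈ U (suc j) 1/2√x ÷ √x * U (suc (suc j)) 1/2√x
  F-zero-laurent = ∼-÷ {F (21-3-⋯- (suc (suc j))) 0} {sq v} {ŵ} {û} Num Den (suc j) 0 (∼-U (suc j)) Den∼ ûv̂≃1 (begin
    û ∙ sq (F (21-3-⋯- (suc (suc j))) 0)                  ≈⟨ sq-∙ (u (suc (suc j))) (F (21-3-⋯- (suc (suc j))) 0) ⟨
    sq (u (suc (suc j)) ∙ F (21-3-⋯- (suc (suc j))) 0)    ≈⟨ sq-cong (F-zero j) ⟩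
    ŵ                                                     ≈⟨ S.*-identityˡ ŵ ⟨
    1ₛ ∙ ŵ                                                ∎)
    where
    open SetoidReasoning S.setoid
    Num = U (suc j) 1/2√x
    Den = √x * U (suc (suc j)) 1/2√x
    -- The factor `√x` lowers the pole order of the Chebyshev factor from j + 2 to j + 1, that of
    -- the numerator; hence the excess 0.
    Den∼ : Den ∼s^- (suc j ℕ.+ 0) · û
    Den∼ = ≡.subst (λ m → Den ∼s^- m · û) (≡.sym (ℕ.+-identityʳ (suc j)))
      (∼-lower Den {suc j} (∼-* √x (U (suc (suc j)) 1/2√x) {0} {suc (suc j)} ∼-√x (∼-U (suc (suc j)))))

  F-suc-laurent : ∀ r → suc r ≤ j → ⟦ F (21-3-⋯- (suc (suc j))) (suc r) ⟧ ≈
    √x ^ r * U (suc j) 1/2√x ^ r ÷ U (suc (suc j)) 1/2√x ^ suc (suc r)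
  F-suc-laurent r r<j = ∼-÷ {F (21-3-⋯- (suc (suc j))) (suc r)} {sq v ^ₛ suc (suc r)} {X ^ₛ r ∙ ŵ ^ₛ r} {û ^ₛ suc (suc r)}
    -- In √x the factors x^r and x^k of `F-suc` become exponents 2r and 2k. The numerator keeps r of
    -- these through `√x ^ r`, and the excess r + 2k is left.
    Num Den (r ℕ.* 0 ℕ.+ r ℕ.* suc j) (r ℕ.+ (k ℕ.+ k))
    (∼-* (√x ^ r) (U (suc j) 1/2√x ^ r) (∼-^ √x r ∼-√x) (∼-^ (U (suc j) 1/2√x) r (∼-U (suc j))))
    (≡.subst (λ m → Den ∼s^- m · û ^ₛ suc (suc r)) exponents (∼-^ (U k 1/2√x) (suc (suc r)) (∼-U k)))
    (^-invertible (suc (suc r)) ûv̂≃1) (begin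
    û ^ₛ suc (suc r) ∙ sq Fᵣ                        ≈⟨ S.*-congʳ {sq Fᵣ} (sq-^ (u k) (suc (suc r))) ⟨
    sq (u k ^ₛ suc (suc r)) ∙ sq Fᵣ                 ≈⟨ sq-∙ (u k ^ₛ suc (suc r)) Fᵣ ⟨
    sq (u k ^ₛ suc (suc r) ∙ Fᵣ)                    ≈⟨ sq-cong (F-suc j r r<j) ⟩
    sq (X ^ₛ r ∙ u (suc j) ^ₛ r ∙ X ^ₛ k)           ≈⟨ sq-∙ (X ^ₛ r ∙ u (suc j) ^ₛ r) (X ^ₛ k) ⟩
    sq (X ^ₛ r ∙ u (suc j) ^ₛ r) ∙ sq (X ^ₛ k)
      ≈⟨ S.*-cong (S.trans (sq-∙ (X ^ₛ r) (u (suc j) ^ₛ r)) (S.*-cong (sq-X^ r) (sq-^ (u (suc j)) r))) (sq-X^ k) ⟩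
    (X ^ₛ r ∙ X ^ₛ r) ∙ ŵ ^ₛ r ∙ (X ^ₛ k ∙ X ^ₛ k)
      ≈⟨ regroup (X ^ₛ r) (ŵ ^ₛ r) (X ^ₛ k) ⟩
    (X ^ₛ r ∙ (X ^ₛ k ∙ X ^ₛ k)) ∙ (X ^ₛ r ∙ ŵ ^ₛ r)
      ≈⟨ S.*-congʳ {X ^ₛ r ∙ ŵ ^ₛ r} (S.trans (^-homo-* X r (k ℕ.+ k)) (S.*-congˡ {X ^ₛ r} (^-homo-* X k k))) ⟨
    X ^ₛ (r ℕ.+ (k ℕ.+ k)) ∙ (X ^ₛ r ∙ ŵ ^ₛ r)      ∎)
    where
    open SetoidReasoning S.setoid
    k  = suc (suc j)
    Fᵣ = F (21-3-⋯- (suc (suc j))) (suc r)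
    Num  = √x ^ r * U (suc j) 1/2√x ^ r
    Den  = U (suc (suc j)) 1/2√x ^ suc (suc r)
    sq-X^ : ∀ n → sq (X ^ₛ n) ≃ X ^ₛ n ∙ X ^ₛ n
    sq-X^ n = S.trans (sq-^ X n) (S.trans (^ₛ-congˡ n sq-X) (^-distrib-* X X n))
    exponents : suc (suc r) ℕ.* k ≡ (r ℕ.* 0 ℕ.+ r ℕ.* suc j) ℕ.+ (r ℕ.+ (k ℕ.+ k))
    exponents = solve 2 (λ r j → (con 2 :+ r) :* (con 2 :+ j) :=
      (r :* con 0 :+ r :* (con 1 :+ j)) :+ (r :+ ((con 2 :+ j) :+ (con 2 :+ j)))) ≡.refl r j
      where open +-*-Solver

theorem2p16 : ∀ (k : ℕ) → 3 ≤ k →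
    (∀ (r : ℕ) → r ≤ k ∸ 2 → IsRational (F (21-3-⋯- k) r))
    × (∀ (r : ℕ) → 1 ≤ r → r ≤ k ∸ 2 →
    ⟦ F (21-3-⋯- k) r ⟧ ≈ √x ^ (r ∸ 1) * U (k ∸ 1) 1/2√x ^ (r ∸ 1) ÷ U k 1/2√x ^ suc r)
    × (⟦ F (21-3-⋯- k) 0 ⟧ ≈ U (k ∸ 1) 1/2√x ÷ √x * U k 1/2√x)
theorem2p16 (suc zero)    (s≤s ())
theorem2p16 (suc (suc j)) _ = F-isRational j , (λ { (suc r) _ r≤j → F-suc-laurent j r r≤j }) , F-zero-laurent j
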